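{- Given a fractional laminar cut family $\mathcal{C}$ feasible for the CSCP on a graph $G$ with integral edge capacities $c_e$, the algorithm Round-1 produces an integral family of cuts $\mathcal{A}$ that is feasible for the CSCP on $G$ with edge capacities $c_e+1$.
   Context: CSCP (common-sink $s$-$t$ cut packing): an undirected graph $G=(V,E)$ with positive integral edge capacities $c_e$, a sink $t\in V$, and $k$ commodities $S_1,\dots,S_k$, each consisting of exactly two terminals, one residing at $t$; terminal $i$ resides at vertex $r_i$, and the two terminals of a commodity reside at different vertices. A cut is a set $C$ with $\emptyset\subsetneq C\subsetneq V$; $\delta(C)$ is the set of edges with exactly one endpoint in $C$. Two cuts $C_1,C_2$ cross if $C_1\cap C_2$, $C_1\setminus C_2$, $C_2\setminus C_1$ are all non-empty. A collection of cuts is laminar if no two of its members cross. A fractional laminar cut family $\mathcal{C}$ for a terminal set $T$ with weight function $w$ is a laminar collection of cuts, each cut being associated with a unique terminal of $T$ (the same vertex set may occur several times), such that, writing $\mathcal{C}_i$ for the cuts associated with $i$, every $C\in\mathcal{C}_i$ contains $r_i$, and $\sum_{C\in\mathcal{C}_i}w(C)=1$ for every $i\in T$. Its load on $e$ is $\ell_e^{\mathcal{C}}=\sum_{C\in\mathcal{C}:\,e\in\delta(C)}w(C)$. The family is feasible for the CSCP with edge capacities $c'_e$ if (1) $T$ is the set of all terminals in $\bigcup_a S_a$ other than those at the sink $t$; (2) $t\notin\bigcup_{C\in\mathcal{C}}C$; (3) $\ell_e^{\mathcal{C}}\le c'_e$ for every $e\in E$. An integral family $\mathcal{A}=\{A_i\}_{i\in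 T}$ (one cut per terminal in $T$) is feasible for the CSCP with edge capacities $c'_e$ if $r_i\in A_i$ and $t\notin A_i$ for every $i\in T$, and $\ell_e^{\mathcal{A}}=|\{i\in T: e\in\delta(A_i)\}|\le c'_e$ for every $e\in E$. Notation (always for the current $\mathcal{C}$): $K_v$ is the set of cuts in $\mathcal{C}$ containing vertex $v$; the depth of $v$ is $\sum_{C\in K_v}w(C)$; the depth of a terminal is that of the vertex at which it resides. For a set of cuts $L=\{L_1,\dots,L_l\}$ with $L_1\subseteq L_2\subseteq\cdots\subseteq L_l$ and weights $w$, $L^x$ denotes the innermost cuts of $L$ of weight exactly $x$: if $l'$ is such that $\sum_{a<l'}w(L_a)<x\le\sum_{a\le l'}w(L_a)$, then $L^x=\{L_1,\dots,L_{l'}\}$ with weights $w'(L_a)=w(L_a)$ for $a<l'$ and $w'(L_{l'})=x-\sum_{a<l'}w(L_a)$. $M(v)$ is the current meta-node (set of merged vertices) containing $v$. Algorithm Round-1. Input: $G$, $c_e$, the terminals $T$ with the fractional laminar cut family $\mathcal{C}$, and the common sink $t\notin\bigcup_{C\in\mathcal{C}}C$. Output: a collection $\mathcal{A}$ of cuts, one for each terminal in $T$. (1) Set $T'=T$, $\mathcal{A}=\emptyset$, $M(v)=\{v\}$ for all $v\in V$; compute the depths of vertices and terminals. (2) While there are terminals in $T'$: (a) Let $i$ be a terminal of maximum depth in $T'$. Let $A_i=M(r_i)$; add $A_i$ to $\mathcal{A}$ and remove $i$ from $T'$. (b) Let $K=K_{r_i}^1$. Remove the cuts in $K\cap\mathcal{C}_i$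 from $K$, $\mathcal{C}_i$ and $\mathcal{C}$. While there is a terminal $j\in T'$ with a cut $C\in K\cap\mathcal{C}_j$: let $w=w(C)$; remove $C$ from $K$, $\mathcal{C}_j$ and $\mathcal{C}$; remove the cuts in $\mathcal{C}_i^{w}$ from $\mathcal{C}_i$ and add them to $\mathcal{C}_j$ (i.e. reassign them from $i$ to $j$). (c) If there is an edge $e=(u,v)$ with $\ell_e^{\mathcal{C}}=0$, merge the meta-nodes $M(u)$ and $M(v)$. (d) Recompute the depths of vertices and terminals.
   Formalization: The weights w(C) of the fractional laminar cut family are taken to be (nonnegative) rational numbers rather than real numbers. -}

module Defs where

open import Data.Fin using (Fin)
import Data.Fin.Properties as Fin
open import Data.Fin.Subset
  using (Subset; _∈_; _∉_; _⊆_; _⊂_; ⊥; ⊤; _∩_; _∪_; _─_; _-_; ⁅_⁆; Nonempty; Empty)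
open import Data.Fin.Subset.Properties using (_∈?_)
open import Data.Integer using (+_)
open import Data.List using (List; []; _∷_; [_]; _++_; map; filter; foldr; length; allFin)
open import Data.List.Membership.Propositional using () renaming (_∈_ to _∈ˡ_)
open import Data.List.Relation.Binary.Permutation.Propositional using (_↭_)
open import Data.List.Relation.Unary.All using (All)
open import Data.List.Relation.Unary.AllPairs using (AllPairs)
open import Data.Nat as ℕ using (ℕ)
open import Data.Product using (∃; _×_; _,_; proj₁; proj₂; map₁)
open import Data.Rational using (ℚ; 0ℚ; 1ℚ; _+_; _≤_; _/_) renaming (_-_ to _-ℚ_)
open import Data.Rational.Properties using (_≤?_; _≟_)
open import Data.Sum using (_⊎_)
open import Data.Vec.Functional using (updateAt)
open import Function using (const)
open import Relation.Binary.PropositionalEquality using (_≡_; _≢_)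
open import Relation.Nullary using (¬_; Dec; yes; no; ¬?; _×-dec_; _⊎-dec_)

-- Edges are named, so parallel edges (and loops, which lie in no δ(C)) are
-- allowed; the order of the two endpoints of an edge carries no meaning.
-- Every commodity has one terminal at the sink, so commodities are in
-- bijection with the terminals not at the sink: `Fin k` indexes both, and
-- `r i` is the vertex of the non-sink terminal of commodity i.
record CSCP : Set where
  field
    n m        : ℕ
    ends       : Fin m → Fin n × Fin n
    capacity   : Fin m → ℕ
    capacity>0 : ∀ e → 0 ℕ.< capacity e
    sink       : Fin n
    k          : ℕ
    r          : Fin k → Fin n
    r≢sink     : ∀ i → r i ≢ sink

  V E T : Set
  V = Fin n
  E = Fin m
  T = Fin k

module _ (P : CSCP) where
  open CSCP P

  IsCut : Subset n → Set
  IsCut C = ⊥ ⊂ C × C ⊂ ⊤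

  Cross : Subset n → Subset n → Set
  Cross C D = Nonempty (C ∩ D) × Nonempty (C ─ D) × Nonempty (D ─ C)

  _∈δ_ : E → Subset n → Set
  e ∈δ C = let (u , v) = ends e in (u ∈ C × v ∉ C) ⊎ (v ∈ C × u ∉ C)

  _∈δ?_ : ∀ e C → Dec (e ∈δ C)
  e ∈δ? C = let (u , v) = ends e in
    ((u ∈? C) ×-dec ¬? (v ∈? C)) ⊎-dec ((v ∈? C) ×-dec ¬? (u ∈? C))

  record WeightedCut : Set where
    constructor cut
    field
      set    : Subset n
      owner  : T
      weight : ℚ
  open WeightedCut

  -- A list is used as a multiset: the same vertex set may occur repeatedly.
  Family : Set
  Family = List WeightedCut

  total : Family → ℚ
  total 𝒞 = foldr _+_ 0ℚ (map weight 𝒞)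

  cutsAt : V → Family → Family
  cutsAt v = filter (λ C → v ∈? set C)

  cutsNotAt : V → Family → Family
  cutsNotAt v = filter (λ C → ¬? (v ∈? set C))

  cutsOf : T → Family → Family
  cutsOf i = filter (λ C → owner C Fin.≟ i)

  cutsNotOf : T → Family → Family
  cutsNotOf i = filter (λ C → ¬? (owner C Fin.≟ i))

  load : Family → E → ℚ
  load 𝒞 e = total (filter (λ C → e ∈δ? set C) 𝒞)

  depth : Family → V → ℚ
  depth 𝒞 v = total (cutsAt v 𝒞)

  record FractionalLaminar (𝒞 : Family) : Set where
    field
      cuts         : All (λ C → IsCut (set C)) 𝒞
      laminar      : ∀ {C D} → C ∈ˡ 𝒞 → D ∈ˡ 𝒞 → ¬ Cross (set C) (set D)
      nonNegative  : All (λ C → 0ℚ ≤ weight C) 𝒞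
      containOwner : All (λ C → r (owner C) ∈ set C) 𝒞
      unit         : ∀ i → total (cutsOf i 𝒞) ≡ 1ℚ

  record FractionalFeasible (c : E → ℕ) (𝒞 : Family) : Set where
    field
      fractionalLaminar : FractionalLaminar 𝒞
      avoidSink         : All (λ C → sink ∉ set C) 𝒞
      load≤             : ∀ e → load 𝒞 e ≤ + c e / 1

  integralLoad : (T → Subset n) → E → ℕ
  integralLoad A e = length (filter (λ i → e ∈δ? A i) (allFin k))

  record IntegralFeasible (c : E → ℕ) (A : T → Subset n) : Set where
    field
      cuts         : ∀ i → IsCut (A i)
      containOwner : ∀ i → r i ∈ A i
      avoidSink    : ∀ i → sink ∉ A i
      load≤        : ∀ e → integralLoad A e ℕ.≤ c e

  Nested : Family → Set
  Nested = AllPairs (λ C D → set C ⊆ set D)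

  -- For nested L, the first component is L^x and the second is what is left
  -- of L.  A cut that L^x uses only in part is split into two copies.
  innermost : ℚ → Family → Family × Family
  innermost x []      = [] , []
  innermost x (C ∷ L) with x ≤? 0ℚ | weight C ≤? x
  ... | yes _ | _     = [] , C ∷ L
  ... | no _  | yes _ = map₁ (C ∷_) (innermost (x -ℚ weight C) L)
  ... | no _  | no _  = [ record C { weight = x } ]
                      , record C { weight = weight C -ℚ x } ∷ L

  MetaNodes : Set
  MetaNodes = V → Subset n

  merge : V → V → MetaNodes → MetaNodes
  merge u v M x with x ∈? (M u ∪ M v)
  ... | yes _ = M u ∪ M v
  ... | no _  = M x

  mergeAlong : Family → E → MetaNodes → MetaNodes
  mergeAlong 𝒞 e M with load 𝒞 e ≟ 0ℚ
  ... | yes _ = merge (proj₁ (ends e)) (proj₂ (ends e)) M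
  ... | no _  = M

  mergeUnloaded : Family → MetaNodes → MetaNodes
  mergeUnloaded 𝒞 M = foldr (mergeAlong 𝒞) M (allFin m)

  -- `outer` is a state at the head of the outer loop.  `inner i K R` is a
  -- state at the head of the inner loop for terminal i; the current family is
  -- K ++ R, where K is the algorithm's set K.  Once the cuts of i in K have
  -- been removed, all the cuts of i lie in R.
  data Config : Set where
    outer : (𝒞 : Family) (T′ : Subset k) (A : T → Subset n) (M : MetaNodes) → Config
    inner : (i : T) (K R : Family) (T′ : Subset k) (A : T → Subset n) (M : MetaNodes) → Config

  -- ⊥ is not a cut; it marks terminals that have not been given a cut yet.
  initial : Family → Config
  initial 𝒞 = outer 𝒞 ⊤ (const ⊥) ⁅_⁆

  -- Choices the algorithm leaves open (among terminals of maximum depth, in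
  -- the order of equal vertex sets in a chain, of the next cut to reassign)
  -- are nondeterministic.
  infix 4 _⟶_
  data _⟶_ : Config → Config → Set where

    select : ∀ {𝒞 T′ A M} i L →
      i ∈ T′ → (∀ j → j ∈ T′ → depth 𝒞 (r j) ≤ depth 𝒞 (r i)) →
      L ↭ cutsAt (r i) 𝒞 → Nested L →
      let (K , K⁺) = innermost 1ℚ L in
      outer 𝒞 T′ A M ⟶
      inner i (cutsNotOf i K) (K⁺ ++ cutsNotAt (r i) 𝒞)
            (T′ - i) (updateAt A i (const (M (r i)))) M

    reassign : ∀ {i K R T′ A M} C K′ L →
      K ↭ C ∷ K′ → owner C ∈ T′ →
      L ↭ cutsOf i R → Nested L →
      let (I , I⁺) = innermost (weight C) L in
      inner i K R T′ A M ⟶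
      inner i K′ (map (λ D → record D { owner = owner C }) I ++ I⁺ ++ cutsNotOf i R) T′ A M

    finish : ∀ {i K R T′ A M} →
      All (λ C → owner C ∉ T′) K →
      inner i K R T′ A M ⟶
      outer (K ++ R) T′ A (mergeUnloaded (K ++ R) M)

  -- Total correctness: whatever choices are made from the given configuration,
  -- the algorithm never gets stuck, terminates, and its output satisfies Q.
  data Produces (Q : (T → Subset n) → Set) : Config → Set where
    done : ∀ {𝒞 T′ A M} → Empty T′ → Q A → Produces Q (outer 𝒞 T′ A M)
    step : ∀ {s} → ∃ (s ⟶_) → (∀ {s′} → s ⟶ s′ → Produces Q s′) → Produces Q s

  Round1Produces : Family → ((T → Subset n) → Set) → Set
  Round1Produces 𝒞 Q = Produces Q (initial 𝒞)

{-# OPTIONS --safe #-}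

-- Split the load of an edge e = (u , v) into the weight x of the cuts containing
-- u but not v and the weight y of those containing v but not u.  When A_i cuts
-- e from the side of u, all cuts at r_i of positive weight contain u.  If x were
-- 0 while y > 0, the owner of a cut around v that misses u would lie deeper than
-- r_i, by laminarity.  So x > 0, and removing the innermost unit of cuts at r_i
-- either lowers x by 1 or, once it reaches a cut containing v, exhausts x.
-- Hence e is cut at most ⌈x⌉ + ⌈y⌉ ≤ c_e + 1 times.  An edge unloaded from the
-- start may be cut in the first round, but it is merged right afterwards.
module Submission where

open import Defs
open import Data.Bool using (if_then_else_)
open import Data.Fin using (Fin)
import Data.Fin.Properties as Fin
open import Data.Fin.Subset as Subset using (Subset; _∈_; _∉_; _⊆_; _∪_; _─_)
open import Data.Fin.Subset.Induction using (⊂-wellFounded; Acc; acc)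
open import Data.Fin.Subset.Properties
import Data.Integer as ℤ
import Data.Integer.Properties as ℤ
open import Data.List using (List; []; _∷_; _++_; map; filter; foldr; length; allFin)
open import Data.List.Membership.Propositional using (find) renaming (_∈_ to _∈ˡ_)
open import Data.List.Membership.Propositional.Properties using (∈-allFin; ∈-∃++)
open import Data.List.Properties using (filter-none)
open import Data.List.Relation.Binary.Permutation.Propositional as ↭
  using (_↭_; ↭-refl; ↭-sym; ↭-trans; prep; swap)
import Data.List.Relation.Binary.Permutation.Propositional.Properties as ↭
open import Data.List.Relation.Unary.All as All using (All; []; _∷_)
import Data.List.Relation.Unary.All.Properties as All
open import Data.List.Relation.Unary.AllPairs using ([]; _∷_)
open import Data.List.Relation.Unary.Any as Any using (here; there)
open import Data.List.Relation.Unary.Unique.Propositional using (Unique)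
import Data.List.Relation.Unary.Unique.Propositional.Properties as Unique
open import Data.Nat as ℕ using (ℕ; zero; suc; z≤n; s≤s)
import Data.Nat.Properties as ℕ
open import Data.Product using (∃; _×_; _,_; proj₁; proj₂)
open import Data.Rational as ℚ using (ℚ; 0ℚ; 1ℚ; _+_; _≤_; _<_; _/_)
import Data.Rational.Properties as ℚ
open import Data.Rational.Solver using (module +-*-Solver)
import Data.Rational.Unnormalised as ℚᵘ
import Data.Rational.Unnormalised.Properties as ℚᵘ
open import Data.Sum as Sum using (_⊎_; inj₁; inj₂; [_,_]′)
import Data.Vec as Vec
open import Data.Vec.Functional using (updateAt)
open import Data.Vec.Functional.Properties using (updateAt-updates; updateAt-minimal)
open import Function using (_∘_; id; const)
open import Relation.Binary.PropositionalEquality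
open import Relation.Nullary
  using (¬_; Dec; yes; no; does; decidable-stable; ¬?; _×-dec_; contradiction)
open import Relation.Unary using (Decidable)
open import Relation.Unary.Properties using (U?)

open +-*-Solver using (solve; _:+_; _:-_; _:=_; con)

-- Loads, depths and separations depend only on the weighted vertex sets, so reassigning and
-- splitting cuts is invisible to them. Reassignment serves another purpose: the removed unit of
-- cuts belongs to several terminals, and i compensates them from its own remaining cuts. Thus every
-- waiting terminal keeps a full unit and every finished one has none. This makes the depth
-- comparison legitimate: the owner of a cut of positive weight is still waiting, so it competes
-- with i for maximum depth.
--
-- Cuts of weight 0 are allowed, and weightless cuts of finished terminals can survive a round.
-- Containment claims are therefore made for cuts of positive weight, and families are compared by
-- weights.
--
-- Ceilings are never formed: a loaded edge carries two integers above its separations, and a round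
-- that cuts the edge lowers one of them.
--
-- The chains it asks for exist because only vertex sets of the laminar input ever occur.

-- Arithmetic of the rationals and rounding up

0≤1 : 0ℚ ≤ 1ℚ
0≤1 = ℚ.nonNegative⁻¹ 1ℚ

<⇒≱ : ∀ {a b} → a < b → ¬ b ≤ a
<⇒≱ a<b b≤a = ℚ.<-irrefl refl (ℚ.<-≤-trans a<b b≤a)

≤∧≢0⇒0< : ∀ {a} → 0ℚ ≤ a → a ≢ 0ℚ → 0ℚ < a
≤∧≢0⇒0< 0≤a a≢0 = ℚ.≰⇒> (λ a≤0 → a≢0 (ℚ.≤-antisym a≤0 0≤a))

0≤b⇒a≤a+b : ∀ {a b} → 0ℚ ≤ b → a ≤ a + b
0≤b⇒a≤a+b {a} {b} 0≤b = subst (_≤ a + b) (ℚ.+-identityʳ a) (ℚ.+-monoʳ-≤ a 0≤b)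

0≤a⇒b≤a+b : ∀ {a b} → 0ℚ ≤ a → b ≤ a + b
0≤a⇒b≤a+b {a} {b} 0≤a = subst (b ≤_) (ℚ.+-comm b a) (0≤b⇒a≤a+b 0≤a)

0≤+ : ∀ {a b} → 0ℚ ≤ a → 0ℚ ≤ b → 0ℚ ≤ a + b
0≤+ 0≤a 0≤b = ℚ.≤-trans 0≤a (0≤b⇒a≤a+b 0≤b)

a+b-a≡b : ∀ a b → a + b ℚ.- a ≡ b
a+b-a≡b = solve 2 (λ a b → a :+ b :- a := b) refl

+-cancelˡ-≡ : ∀ a {b c} → a + b ≡ a + c → b ≡ c
+-cancelˡ-≡ a {b} {c} eq = trans (sym (a+b-a≡b a b)) (trans (cong (ℚ._- a) eq) (a+b-a≡b a c))

+-cancelˡ-≤ : ∀ a {b c} → a + b ≤ a + c → b ≤ c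
+-cancelˡ-≤ a {b} {c} le = subst₂ _≤_ (a+b-a≡b a b) (a+b-a≡b a c) (ℚ.+-monoˡ-≤ (ℚ.- a) le)

+≡0ˡ : ∀ {a b} → 0ℚ ≤ a → 0ℚ ≤ b → a + b ≡ 0ℚ → a ≡ 0ℚ
+≡0ˡ {a} {b} 0≤a 0≤b eq = ℚ.≤-antisym (subst (a ≤_) eq (0≤b⇒a≤a+b 0≤b)) 0≤a

+≡0ʳ : ∀ {a b} → 0ℚ ≤ a → 0ℚ ≤ b → a + b ≡ 0ℚ → b ≡ 0ℚ
+≡0ʳ {a} {b} 0≤a 0≤b eq = +≡0ˡ 0≤b 0≤a (trans (ℚ.+-comm b a) eq)

a+[b-a]≡b : ∀ a b → a + (b ℚ.- a) ≡ b
a+[b-a]≡b = solve 2 (λ a b → a :+ (b :- a) := b) refl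

a≤b⇒0≤b-a : ∀ {a b} → a ≤ b → 0ℚ ≤ b ℚ.- a
a≤b⇒0≤b-a {a} {b} a≤b = subst (_≤ b ℚ.- a) (ℚ.+-inverseʳ a) (ℚ.+-monoˡ-≤ (ℚ.- a) a≤b)

+-interchange : ∀ a b c d → (a + b) + (c + d) ≡ (a + c) + (b + d)
+-interchange = solve 4 (λ a b c d → (a :+ b) :+ (c :+ d) := (a :+ c) :+ (b :+ d)) refl

+-exchange : ∀ a b c → a + (b + c) ≡ b + (a + c)
+-exchange = solve 3 (λ a b c → a :+ (b :+ c) := b :+ (a :+ c)) refl

-- Recursion makes `fromℕ (suc p)` unfold to `1ℚ + fromℕ p`, so a unit saved in a round cancels by
-- `+-cancelˡ-≤`. The capacities of the statement enter through `/1≡fromℕ`.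
fromℕ : ℕ → ℚ
fromℕ zero    = 0ℚ
fromℕ (suc n) = 1ℚ + fromℕ n

0≤fromℕ : ∀ n → 0ℚ ≤ fromℕ n
0≤fromℕ zero    = ℚ.≤-refl
0≤fromℕ (suc n) = 0≤+ 0≤1 (0≤fromℕ n)

/1≡fromℕ : ∀ n → ℤ.+ n / 1 ≡ fromℕ n
/1≡fromℕ zero    = refl
/1≡fromℕ (suc n) = trans (ℚ.toℚᵘ-injective suc-homo) (cong (1ℚ +_) (/1≡fromℕ n))
  where
  suc-homo : ℚ.toℚᵘ (ℤ.+ suc n / 1) ℚᵘ.≃ ℚ.toℚᵘ (1ℚ + (ℤ.+ n / 1))
  suc-homo = ℚᵘ.≃-trans (ℚ.toℚᵘ-fromℚᵘ (ℚᵘ.mkℚᵘ (ℤ.+ suc n) 0))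
    (ℚᵘ.≃-trans (ℚᵘ.*≡* (cong (λ k → (ℤ.+ 1 ℤ.+ k) ℤ.* ℤ.+ 1) (sym (ℤ.*-identityʳ (ℤ.+ n)))))
    (ℚᵘ.≃-sym (ℚᵘ.≃-trans (ℚ.toℚᵘ-homo-+ 1ℚ (ℤ.+ n / 1))
      (ℚᵘ.+-congʳ (ℚ.toℚᵘ 1ℚ) (ℚ.toℚᵘ-fromℚᵘ (ℚᵘ.mkℚᵘ (ℤ.+ n) 0))))))

-- ⌈a⌉ + ⌈b⌉ ≤ c + 1, without ceilings.
integer-bounds : ∀ c {a b} → 0ℚ ≤ a → 0ℚ ≤ b → a + b ≤ fromℕ c →
  ∃ λ p → ∃ λ q → a ≤ fromℕ p × b ≤ fromℕ q × p ℕ.+ q ℕ.≤ suc c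
integer-bounds zero 0≤a 0≤b a+b≤0 =
  0 , 0 , ℚ.≤-trans (0≤b⇒a≤a+b 0≤b) a+b≤0 , ℚ.≤-trans (0≤a⇒b≤a+b 0≤a) a+b≤0 , z≤n
integer-bounds (suc c) {a} {b} 0≤a 0≤b a+b≤c with a ℚ.≤? 1ℚ
-- Rounding `a` up to 1, even from 0, spends exactly the extra unit, because `b` alone is at most
-- the whole capacity.
... | yes a≤1 = 1 , suc c , a≤1 , ℚ.≤-trans (0≤a⇒b≤a+b 0≤a) a+b≤c , ℕ.≤-refl
... | no a≰1 =
  let p , q , a-1≤p , b≤q , p+q≤c = integer-bounds c {a ℚ.- 1ℚ} 0≤a-1 0≤b
        (+-cancelˡ-≤ 1ℚ (subst (_≤ fromℕ (suc c)) (regroup a b) a+b≤c))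
  in suc p , q , subst (_≤ fromℕ (suc p)) (1+a-1≡a a) (ℚ.+-monoʳ-≤ 1ℚ a-1≤p) , b≤q , s≤s p+q≤c
  where
  regroup : ∀ a b → a + b ≡ 1ℚ + ((a ℚ.- 1ℚ) + b)
  regroup = solve 2 (λ a b → a :+ b := con 1ℚ :+ ((a :- con 1ℚ) :+ b)) refl
  1+a-1≡a : ∀ a → 1ℚ + (a ℚ.- 1ℚ) ≡ a
  1+a-1≡a = solve 1 (λ a → con 1ℚ :+ (a :- con 1ℚ) := a) refl
  0≤a-1 : 0ℚ ≤ a ℚ.- 1ℚ
  0≤a-1 = ℚ.+-monoˡ-≤ (ℚ.- 1ℚ) (ℚ.<⇒≤ (ℚ.≰⇒> a≰1))

-- Total weight of the list members that satisfy a predicate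

part : ∀ {X : Set} → Dec X → ℚ → ℚ
part X? a = if does X? then a else 0ℚ

0≤part : ∀ {X : Set} (X? : Dec X) {a} → 0ℚ ≤ a → 0ℚ ≤ part X? a
0≤part (yes _) 0≤a = 0≤a
0≤part (no _)  0≤a = ℚ.≤-refl

module Mass {A : Set} (w : A → ℚ) where

  mass : {X : A → Set} → Decidable X → List A → ℚ
  mass X? []       = 0ℚ
  mass X? (x ∷ xs) = part (X? x) (w x) + mass X? xs

  NonNegative : List A → Set
  NonNegative = All (λ x → 0ℚ ≤ w x)

  private variable
    X Y Z : A → Set
    xs ys : List A
    x : A

  sum-filter : (X? : Decidable X) → ∀ xs → foldr _+_ 0ℚ (map w (filter X? xs)) ≡ mass X? xs
  sum-filter X? []       = refl
  sum-filter X? (x ∷ xs) with X? x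
  ... | yes _ = cong (w x +_) (sum-filter X? xs)
  ... | no _  = trans (sum-filter X? xs) (sym (ℚ.+-identityˡ _))

  mass-++ : (X? : Decidable X) → ∀ xs ys → mass X? (xs ++ ys) ≡ mass X? xs + mass X? ys
  mass-++ X? []       ys = sym (ℚ.+-identityˡ _)
  mass-++ X? (x ∷ xs) ys =
    trans (cong (part (X? x) (w x) +_) (mass-++ X? xs ys))
          (sym (ℚ.+-assoc (part (X? x) (w x)) (mass X? xs) (mass X? ys)))

  mass-↭ : (X? : Decidable X) → xs ↭ ys → mass X? xs ≡ mass X? ys
  mass-↭ X? ↭.refl                 = refl
  mass-↭ X? (prep x p)             = cong (part (X? x) (w x) +_) (mass-↭ X? p)
  mass-↭ X? (swap {xs} {ys} x y p) = trans (cong (λ m → part (X? x) (w x) + (part (X? y) (w y) + m)) (mass-↭ X? p))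
    (+-exchange (part (X? x) (w x)) (part (X? y) (w y)) (mass X? ys))
  mass-↭ X? (↭.trans p q)          = trans (mass-↭ X? p) (mass-↭ X? q)

  mass-filter-¬? : (X? : Decidable X) (Y? : Decidable Y) → ∀ xs →
    mass X? (filter Y? xs) + mass X? (filter (¬? ∘ Y?) xs) ≡ mass X? xs
  mass-filter-¬? X? Y? []       = refl
  mass-filter-¬? X? Y? (x ∷ xs) with Y? x
  ... | yes _ = trans (ℚ.+-assoc (part (X? x) (w x)) (mass X? (filter Y? xs)) (mass X? (filter (¬? ∘ Y?) xs)))
                      (cong (part (X? x) (w x) +_) (mass-filter-¬? X? Y? xs))
  ... | no _  = trans (+-exchange (mass X? (filter Y? xs)) (part (X? x) (w x)) (mass X? (filter (¬? ∘ Y?) xs)))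
                      (cong (part (X? x) (w x) +_) (mass-filter-¬? X? Y? xs))

  0≤mass : (X? : Decidable X) → NonNegative xs → 0ℚ ≤ mass X? xs
  0≤mass         X? []           = ℚ.≤-refl
  0≤mass {xs = x ∷ _} X? (0≤wx ∷ 0≤w) = 0≤+ (0≤part (X? x) 0≤wx) (0≤mass X? 0≤w)

  -- Restricting the implication to positive weights matters: zero separation says nothing about
  -- weightless cuts, and these may lie anywhere in the family.
  mass-mono : (X? : Decidable X) (Y? : Decidable Y) → NonNegative xs →
    All (λ x → 0ℚ < w x → X x → Y x) xs → mass X? xs ≤ mass Y? xs
  mass-mono X? Y? [] [] = ℚ.≤-refl
  mass-mono {xs = x ∷ xs} X? Y? (0≤wx ∷ 0≤w) (X⇒Y ∷ X⇒Ys) =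
    ℚ.+-mono-≤ (part-mono (X? x) (Y? x)) (mass-mono X? Y? 0≤w X⇒Ys)
    where
    part-mono : (X? : Dec _) (Y? : Dec _) → part X? (w x) ≤ part Y? (w x)
    part-mono X?      (yes _) with X?
    ... | yes _ = ℚ.≤-refl
    ... | no _  = 0≤wx
    part-mono (no _)  (no _)  = ℚ.≤-refl
    part-mono (yes a) (no ¬b) = ℚ.≮⇒≥ (λ 0<wx → ¬b (X⇒Y 0<wx a))

  mass-cong : (X? : Decidable X) (Y? : Decidable Y) → NonNegative xs →
    All (λ x → 0ℚ < w x → X x → Y x) xs → All (λ x → 0ℚ < w x → Y x → X x) xs →
    mass X? xs ≡ mass Y? xs
  mass-cong X? Y? 0≤w X⇒Y Y⇒X = ℚ.≤-antisym (mass-mono X? Y? 0≤w X⇒Y) (mass-mono Y? X? 0≤w Y⇒X)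

  mass-none : (X? : Decidable X) → NonNegative xs → All (λ x → 0ℚ < w x → ¬ X x) xs → mass X? xs ≡ 0ℚ
  mass-none X? [] [] = refl
  mass-none {xs = x ∷ xs} X? (0≤wx ∷ 0≤w) (¬Xx ∷ ¬Xs) with X? x
  ... | no _  = trans (ℚ.+-identityˡ _) (mass-none X? 0≤w ¬Xs)
  ... | yes a = cong₂ _+_ (ℚ.≤-antisym (ℚ.≮⇒≥ (λ 0<wx → ¬Xx 0<wx a)) 0≤wx) (mass-none X? 0≤w ¬Xs)

  weight≤mass : (X? : Decidable X) → NonNegative xs → x ∈ˡ xs → X x → w x ≤ mass X? xs
  weight≤mass {x = x} X? (_ ∷ 0≤w) (here refl) Xx with X? x
  ... | yes _ = 0≤b⇒a≤a+b (0≤mass X? 0≤w)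
  ... | no ¬X = contradiction Xx ¬X
  weight≤mass {xs = y ∷ _} X? (0≤wy ∷ 0≤w) (there x∈xs) Xx =
    ℚ.≤-trans (weight≤mass X? 0≤w x∈xs Xx) (0≤a⇒b≤a+b (0≤part (X? y) 0≤wy))

  mass≤0⇒none : (X? : Decidable X) → NonNegative xs → mass X? xs ≤ 0ℚ → x ∈ˡ xs → 0ℚ < w x → ¬ X x
  mass≤0⇒none X? 0≤w m≤0 x∈xs 0<wx Xx =
    <⇒≱ 0<wx (ℚ.≤-trans (weight≤mass X? 0≤w x∈xs Xx) m≤0)

  mass>0⇒some : (X? : Decidable X) → NonNegative xs → 0ℚ < mass X? xs → ∃ λ x → x ∈ˡ xs × 0ℚ < w x × X x
  mass>0⇒some X? [] 0<0 = contradiction refl (ℚ.<⇒≢ 0<0)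
  mass>0⇒some {xs = x ∷ xs} X? (0≤wx ∷ 0≤w) 0<m with X? x
  ... | no _ = let y , y∈xs , r = mass>0⇒some X? 0≤w (subst (0ℚ <_) (ℚ.+-identityˡ _) 0<m)
               in y , there y∈xs , r
  ... | yes Xx with 0ℚ ℚ.<? w x
  ...   | yes 0<wx = x , here refl , 0<wx , Xx
  ...   | no 0≮wx = let y , y∈xs , r = mass>0⇒some X? 0≤w (ℚ.<-≤-trans 0<m
                          (subst (w x + mass X? xs ≤_) (ℚ.+-identityˡ _) (ℚ.+-monoˡ-≤ (mass X? xs) (ℚ.≮⇒≥ 0≮wx))))
                    in y , there y∈xs , r

  mass-disjoint : (X? : Decidable X) (Y? : Decidable Y) (Z? : Decidable Z) → NonNegative xs →
    (∀ {x} → X x → Z x) → (∀ {x} → Y x → Z x) → (∀ {x} → X x → ¬ Y x) →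
    mass X? xs + mass Y? xs ≤ mass Z? xs
  mass-disjoint X? Y? Z? [] _ _ _ = ℚ.≤-refl
  mass-disjoint {xs = x ∷ xs} X? Y? Z? (0≤wx ∷ 0≤w) X⇒Z Y⇒Z X⇒¬Y =
    subst (_≤ mass Z? (x ∷ xs)) (+-interchange (part (X? x) (w x)) (part (Y? x) (w x)) (mass X? xs) (mass Y? xs))
      (ℚ.+-mono-≤ (parts (X? x) (Y? x) (Z? x)) (mass-disjoint X? Y? Z? 0≤w X⇒Z Y⇒Z X⇒¬Y))
    where
    parts : (X? : Dec _) (Y? : Dec _) (Z? : Dec _) → part X? (w x) + part Y? (w x) ≤ part Z? (w x)
    parts (yes a) (yes b) _       = contradiction b (X⇒¬Y a)
    parts (yes _) (no _)  (yes _) = ℚ.≤-reflexive (ℚ.+-identityʳ _)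
    parts (no _)  (yes _) (yes _) = ℚ.≤-reflexive (ℚ.+-identityˡ _)
    parts (yes a) (no _)  (no ¬c) = contradiction (X⇒Z a) ¬c
    parts (no _)  (yes b) (no ¬c) = contradiction (Y⇒Z b) ¬c
    parts (no _)  (no _)  Z?      = subst (_≤ part Z? (w x)) (sym (ℚ.+-identityˡ 0ℚ)) (0≤part Z? 0≤wx)

  mass-mono-< : (X? : Decidable X) (Y? : Decidable Y) → NonNegative xs →
    All (λ x → 0ℚ < w x → X x → Y x) xs → x ∈ˡ xs → 0ℚ < w x → ¬ X x → Y x → mass X? xs < mass Y? xs
  mass-mono-< {xs = x ∷ xs} X? Y? (0≤wx ∷ 0≤w) (_ ∷ X⇒Ys) (here refl) 0<wx ¬Xx Yx with X? x | Y? x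
  ... | yes Xx | _     = contradiction Xx ¬Xx
  ... | no _   | no ¬Y = contradiction Yx ¬Y
  ... | no _   | yes _ = ℚ.+-mono-<-≤ 0<wx (mass-mono X? Y? 0≤w X⇒Ys)
  mass-mono-< {xs = y ∷ xs} X? Y? (0≤wy ∷ 0≤w) (X⇒Y ∷ X⇒Ys) (there x∈xs) 0<wx ¬Xx Yx =
    ℚ.+-mono-≤-< (part-mono (X? y) (Y? y)) (mass-mono-< X? Y? 0≤w X⇒Ys x∈xs 0<wx ¬Xx Yx)
    where
    part-mono : (X? : Dec _) (Y? : Dec _) → part X? (w y) ≤ part Y? (w y)
    part-mono (yes _) (yes _) = ℚ.≤-refl
    part-mono (no _)  (yes _) = 0≤wy
    part-mono (no _)  (no _)  = ℚ.≤-refl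
    part-mono (yes a) (no ¬b) = ℚ.≮⇒≥ (λ 0<wy → ¬b (X⇒Y 0<wy a))

  mass-map : (f : A → A) (X? : Decidable X) (Y? : Decidable Y) →
    (∀ x → does (X? (f x)) ≡ does (Y? x)) → (∀ x → w (f x) ≡ w x) → ∀ xs →
    mass X? (map f xs) ≡ mass Y? xs
  mass-map f X? Y? X≗Y w-f []       = refl
  mass-map f X? Y? X≗Y w-f (x ∷ xs) =
    cong₂ _+_ (cong₂ (λ b a → if b then a else 0ℚ) (X≗Y x) (w-f x)) (mass-map f X? Y? X≗Y w-f xs)

  mass-U-filter : (X? : Decidable X) → ∀ xs → mass U? (filter X? xs) ≡ mass X? xs
  mass-U-filter X? []       = refl
  mass-U-filter X? (x ∷ xs) with X? x
  ... | yes _ = cong (w x +_) (mass-U-filter X? xs)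
  ... | no _  = trans (mass-U-filter X? xs) (sym (ℚ.+-identityˡ _))

  mass-const : ∀ {X : Set} (X? : Dec X) xs → mass (λ _ → X?) xs ≡ part X? (mass U? xs)
  mass-const (yes _) []       = refl
  mass-const (no _)  []       = refl
  mass-const (yes p) (x ∷ xs) = cong (w x +_) (mass-const (yes p) xs)
  mass-const (no ¬p) (x ∷ xs) = trans (ℚ.+-identityˡ _) (mass-const (no ¬p) xs)

part-yes : ∀ {X : Set} (X? : Dec X) {a} → X → part X? a ≡ a
part-yes (yes _) _ = refl
part-yes (no ¬p) p = contradiction p ¬p

part-no : ∀ {X : Set} (X? : Dec X) {a} → ¬ X → part X? a ≡ 0ℚ
part-no (yes p) ¬p = contradiction p ¬p
part-no (no _)  _  = refl

-- Counting and maximising over lists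

module _ {A : Set} {X Y : A → Set} (X? : Decidable X) (Y? : Decidable Y) where

  length-filter-mono : ∀ {xs} → All (λ x → X x → Y x) xs → length (filter X? xs) ℕ.≤ length (filter Y? xs)
  length-filter-mono []                      = z≤n
  length-filter-mono (_∷_ {x = x} X⇒Y X⇒Ys) with X? x | Y? x
  ... | yes a | no ¬b = contradiction (X⇒Y a) ¬b
  ... | yes _ | yes _ = s≤s (length-filter-mono X⇒Ys)
  ... | no _  | yes _ = ℕ.m≤n⇒m≤1+n (length-filter-mono X⇒Ys)
  ... | no _  | no _  = length-filter-mono X⇒Ys

  -- Only `i` may be counted on the left and not on the right. In a list without repetitions no
  -- second `i` follows, so plain monotonicity handles the rest.
  length-filter-≤-suc : ∀ {i} → (∀ x → Dec (x ≡ i)) → (∀ {x} → x ≢ i → X x → Y x) → ∀ {xs} → Unique xs →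
    length (filter X? xs) ℕ.≤ suc (length (filter Y? xs))
  length-filter-≤-suc ≟i X⇒Y {[]}     []         = z≤n
  length-filter-≤-suc ≟i X⇒Y {x ∷ xs} (x∉xs ∷ u) with X? x | Y? x
  ... | no _  | yes _ = ℕ.m≤n⇒m≤1+n (length-filter-≤-suc ≟i X⇒Y u)
  ... | no _  | no _  = length-filter-≤-suc ≟i X⇒Y u
  ... | yes _ | yes _ = s≤s (length-filter-≤-suc ≟i X⇒Y u)
  ... | yes a | no ¬b with ≟i x
  ...   | no x≢i   = contradiction (X⇒Y x≢i a) ¬b
  ...   | yes refl = s≤s (length-filter-mono (All.map (λ x≢y → X⇒Y (x≢y ∘ sym)) x∉xs))

argmax : ∀ {A : Set} {X : A → Set} (X? : Decidable X) (f : A → ℚ) (xs : List A) →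
  (∀ {x} → x ∈ˡ xs → ¬ X x) ⊎ (∃ λ i → X i × (∀ {x} → x ∈ˡ xs → X x → f x ≤ f i))
argmax X? f []       = inj₁ λ ()
argmax X? f (x ∷ xs) with X? x | argmax X? f xs
... | no ¬Xx | inj₁ none = inj₁ λ { (here refl) → ¬Xx ; (there x∈xs) → none x∈xs }
... | no ¬Xx | inj₂ (i , Xi , max) = inj₂ (i , Xi , λ
  { (here refl) Xx → contradiction Xx ¬Xx ; (there x∈xs) → max x∈xs })
... | yes Xx | inj₁ none = inj₂ (x , Xx , λ
  { (here refl) _ → ℚ.≤-refl ; (there y∈xs) Xy → contradiction Xy (none y∈xs) })
... | yes Xx | inj₂ (i , Xi , max) with f x ℚ.≤? f i
...   | yes fx≤fi = inj₂ (i , Xi , λ { (here refl) _ → fx≤fi ; (there y∈xs) → max y∈xs })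
...   | no fx≰fi  = inj₂ (x , Xx , λ
  { (here refl) _ → ℚ.≤-refl ; (there y∈xs) Xy → ℚ.≤-trans (max y∈xs Xy) (ℚ.<⇒≤ (ℚ.≰⇒> fx≰fi)) })

part-⇔ : ∀ {X Y : Set} (X? : Dec X) (Y? : Dec Y) {a} → (X → Y) → (Y → X) → part X? a ≡ part Y? a
part-⇔ (yes p) Y?      X⇒Y Y⇒X = sym (part-yes Y? (X⇒Y p))
part-⇔ (no ¬p) Y?      X⇒Y Y⇒X = sym (part-no Y? (¬p ∘ Y⇒X))

x∉p-x : ∀ {n} (p : Subset n) x → x ∉ p Subset.- x
x∉p-x (_ Vec.∷ p) Fin.zero    ()
x∉p-x (_ Vec.∷ p) (Fin.suc x) (Vec.there x∈) = x∉p-x p x x∈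

-- Integral loads and chains of non-crossing sets

module _ (P : CSCP) where
  open CSCP P
  open WeightedCut
  open Mass (weight {P})

  integralLoad-mono : ∀ A B e → (∀ i → _∈δ_ P e (A i) → _∈δ_ P e (B i)) →
    integralLoad P A e ℕ.≤ integralLoad P B e
  integralLoad-mono A B e A⇒B = length-filter-mono _ _ (All.universal A⇒B (allFin k))

  integralLoad-≤-suc : ∀ A B e i → (∀ j → j ≢ i → A j ≡ B j) → integralLoad P A e ℕ.≤ suc (integralLoad P B e)
  integralLoad-≤-suc A B e i A≡B = length-filter-≤-suc _ _ (Fin._≟ i)
    (λ {j} j≢i → subst (_∈δ_ P e) (A≡B j j≢i)) (Unique.allFin⁺ k)

  ¬cross⇒⊆⊎⊇ : ∀ {C D v} → v ∈ C → v ∈ D → ¬ Cross P C D → C ⊆ D ⊎ D ⊆ C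
  ¬cross⇒⊆⊎⊇ {C} {D} {v} v∈C v∈D ¬cross with nonempty? (C ─ D) | nonempty? (D ─ C)
  ... | yes C─D | yes D─C = contradiction ((v , x∈p∩q⁺ (v∈C , v∈D)) , C─D , D─C) ¬cross
  ... | no ¬C─D | _       = inj₁ λ {x} x∈C → decidable-stable (x ∈? D)
    (λ x∉D → ¬C─D (x , x∈p∧x∉q⇒x∈p─q x∈C x∉D))
  ... | yes _   | no ¬D─C = inj₂ λ {x} x∈D → decidable-stable (x ∈? C)
    (λ x∉C → ¬D─C (x , x∈p∧x∉q⇒x∈p─q x∈D x∉C))

  module _ {X : WeightedCut P → Set}
           (chain : ∀ {C D} → X C → X D → set C ⊆ set D ⊎ set D ⊆ set C) where

    nested-insert : ∀ {C L} → X C → All X L → Nested P L → ∃ λ L′ → L′ ↭ C ∷ L × Nested P L′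
    nested-insert {C} XC []                 []           = C ∷ [] , ↭-refl , [] ∷ []
    nested-insert {C} {D ∷ L} XC (XD ∷ XL) (D⊆L ∷ nested) with chain XC XD
    ... | inj₁ C⊆D = C ∷ D ∷ L , ↭-refl , ((λ {x} → C⊆D) ∷ All.map (λ D⊆E {x} x∈ → D⊆E (C⊆D x∈)) D⊆L) ∷ D⊆L ∷ nested
    ... | inj₂ D⊆C with nested-insert XC XL nested
    ...   | L′ , L′↭C∷L , nested′ =
      D ∷ L′ , ↭-trans (prep D L′↭C∷L) (swap D C ↭-refl) ,
      ↭.All-resp-↭ (↭-sym L′↭C∷L) ((λ {x} → D⊆C) ∷ D⊆L) ∷ nested′

    -- Insertion sort by inclusion. Laminarity makes two cuts comparable only when they share a
    -- vertex, so comparability is assumed relative to `X`, which will say that a fixed vertex lies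
    -- inside.
    nested-sort : ∀ {L} → All X L → ∃ λ L′ → L′ ↭ L × Nested P L′
    nested-sort []                = [] , ↭-refl , []
    nested-sort (_∷_ {x = C} XC XL) with nested-sort XL
    ... | L′ , L′↭L , nested with nested-insert XC (↭.All-resp-↭ (↭-sym L′↭L) XL) nested
    ...   | L″ , L″↭C∷L′ , nested′ = L″ , ↭-trans L″↭C∷L′ (prep C L′↭L) , nested′

  -- The innermost cuts of given weight

  innermost-All : ∀ {X : WeightedCut P → Set} →
    (∀ {C a} → 0ℚ ≤ a → X C → X (record C { weight = a })) →
    ∀ x L → All X L → let I , I⁺ = innermost P x L in All X I × All X I⁺
  innermost-All reweigh x []      []        = [] , []
  innermost-All reweigh x (C ∷ L) (XC ∷ XL) with x ℚ.≤? 0ℚ | weight C ℚ.≤? x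
  ... | yes _  | _       = [] , XC ∷ XL
  ... | no _   | yes _   = let XI , XI⁺ = innermost-All reweigh (x ℚ.- weight C) L XL in XC ∷ XI , XI⁺
  ... | no x≰0 | no w≰x  =
    reweigh (ℚ.<⇒≤ (ℚ.≰⇒> x≰0)) XC ∷ [] , reweigh (a≤b⇒0≤b-a (ℚ.<⇒≤ (ℚ.≰⇒> w≰x))) XC ∷ XL

  -- The two copies of a split cut have weights adding up to the original, so no weight is lost as
  -- long as the predicate ignores weights. For tests of `set` or `owner` that condition is `refl`.
  innermost-mass : ∀ {X : WeightedCut P → Set} (X? : Decidable X) →
    (∀ C a → does (X? (record C { weight = a })) ≡ does (X? C)) →
    ∀ x L → let I , I⁺ = innermost P x L in mass X? I + mass X? I⁺ ≡ mass X? L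
  innermost-mass X? reweigh x []      = refl
  innermost-mass X? reweigh x (C ∷ L) with x ℚ.≤? 0ℚ | weight C ℚ.≤? x
  ... | yes _ | _     = ℚ.+-identityˡ _
  ... | no _  | yes _ = let I , I⁺ = innermost P (x ℚ.- weight C) L in
    trans (ℚ.+-assoc (part (X? C) (weight C)) (mass X? I) (mass X? I⁺))
          (cong (part (X? C) (weight C) +_) (innermost-mass X? reweigh (x ℚ.- weight C) L))
  ... | no _  | no _ rewrite reweigh C x | reweigh C (weight C ℚ.- x) with X? C
  ...   | yes _ = split x (weight C) (mass X? L)
    where
    split : ∀ x w m → (x + 0ℚ) + ((w ℚ.- x) + m) ≡ w + m
    split = solve 3 (λ x w m → (x :+ con 0ℚ) :+ ((w :- x) :+ m) := w :+ m) refl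
  ...   | no _  = ℚ.+-identityˡ _

  innermost-weight : ∀ x L → 0ℚ ≤ x → x ≤ mass U? L → mass U? (proj₁ (innermost P x L)) ≡ x
  innermost-weight x []      0≤x x≤0 = ℚ.≤-antisym 0≤x x≤0
  innermost-weight x (C ∷ L) 0≤x x≤L with x ℚ.≤? 0ℚ | weight C ℚ.≤? x
  ... | yes x≤0 | _       = ℚ.≤-antisym 0≤x x≤0
  ... | no _    | no _    = ℚ.+-identityʳ x
  ... | no _    | yes w≤x =
    trans (cong (weight C +_) (innermost-weight (x ℚ.- weight C) L (a≤b⇒0≤b-a w≤x)
            (+-cancelˡ-≤ (weight C) (subst (_≤ weight C + mass U? L) (sym (a+[b-a]≡b (weight C) x)) x≤L))))
          (a+[b-a]≡b (weight C) x)

  -- A split cut occurs in both pieces with the same set, whence the non-strict inclusion. This is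
  -- the source of `K-innermost` and of the first case of `separation-drop`.
  innermost-⊆ : ∀ x {L} → Nested P L →
    let I , I⁺ = innermost P x L in All (λ D → All (λ C → set C ⊆ set D) I) I⁺
  innermost-⊆ x []                            = []
  innermost-⊆ x (_∷_ {x = C} {xs = L} C⊆L nested) with x ℚ.≤? 0ℚ | weight C ℚ.≤? x
  ... | yes _ | _     = [] ∷ All.map (λ _ → []) C⊆L
  ... | no _  | no _  = ((λ {x} → id) ∷ []) ∷ All.map (λ C⊆D → (λ {x} → C⊆D) ∷ []) C⊆L
  ... | no _  | yes _ = All.zipWith (λ (C⊆D , I⊆D) → (λ {x} → C⊆D) ∷ I⊆D)
    (proj₂ (innermost-All (λ _ → id) (x ℚ.- weight C) L C⊆L) , innermost-⊆ (x ℚ.- weight C) nested)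

  -- Directed separation of vertices

  Separates : V → V → Subset n → Set
  Separates u v S = u ∈ S × v ∉ S

  separates? : ∀ u v → Decidable (Separates u v)
  separates? u v S = (u ∈? S) ×-dec ¬? (v ∈? S)

  -- For the two orders of the endpoints of an edge these are the x and y of the overview. The
  -- quantity is a directed distance, and its vanishing is a preorder on vertices.
  separation : Family P → V → V → ℚ
  separation 𝒞 u v = mass (separates? u v ∘ set) 𝒞

  load≡mass : ∀ 𝒞 e → load P 𝒞 e ≡ mass (_∈δ?_ P e ∘ set) 𝒞
  load≡mass 𝒞 e = sum-filter (_∈δ?_ P e ∘ set) 𝒞

  depth≡mass : ∀ 𝒞 v → depth P 𝒞 v ≡ mass (λ C → v ∈? set C) 𝒞
  depth≡mass 𝒞 v = sum-filter (λ C → v ∈? set C) 𝒞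

  source target : E → V
  source e = proj₁ (ends e)
  target e = proj₂ (ends e)

  module _ {𝒞 : Family P} (w≥0 : NonNegative 𝒞) where

    together : ∀ {u v C} → separation 𝒞 u v ≡ 0ℚ → C ∈ˡ 𝒞 → 0ℚ < weight C → u ∈ set C → v ∈ set C
    together {u} {v} {C} sep≡0 C∈𝒞 0<w u∈C = decidable-stable (v ∈? set C)
      (λ v∉C → mass≤0⇒none (separates? u v ∘ set) w≥0 (ℚ.≤-reflexive sep≡0) C∈𝒞 0<w (u∈C , v∉C))

    separation≡0 : ∀ {u v} → (∀ {C} → C ∈ˡ 𝒞 → 0ℚ < weight C → u ∈ set C → v ∈ set C) → separation 𝒞 u v ≡ 0ℚ
    separation≡0 {u} {v} u⇒v = mass-none (separates? u v ∘ set) w≥0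
      (All.tabulate (λ C∈𝒞 0<w (u∈C , v∉C) → v∉C (u⇒v C∈𝒞 0<w u∈C)))

    separation-trans : ∀ {u v x} → separation 𝒞 u v ≡ 0ℚ → separation 𝒞 v x ≡ 0ℚ → separation 𝒞 u x ≡ 0ℚ
    separation-trans u~v v~x = separation≡0 (λ C∈𝒞 0<w → together v~x C∈𝒞 0<w ∘ together u~v C∈𝒞 0<w)

    separation≤load : ∀ e → separation 𝒞 (source e) (target e) + separation 𝒞 (target e) (source e) ≤ load P 𝒞 e
    separation≤load e = subst (separation 𝒞 (source e) (target e) + separation 𝒞 (target e) (source e) ≤_)
      (sym (load≡mass 𝒞 e))
      (mass-disjoint (separates? (source e) (target e) ∘ set) (separates? (target e) (source e) ∘ set)
        (_∈δ?_ P e ∘ set) w≥0 inj₁ inj₂ (λ (u∈C , _) (_ , u∉C) → u∉C u∈C))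

    unloaded⇒separation≡0 : ∀ e → load P 𝒞 e ≡ 0ℚ →
      separation 𝒞 (source e) (target e) ≡ 0ℚ × separation 𝒞 (target e) (source e) ≡ 0ℚ
    unloaded⇒separation≡0 e load≡0 = +≡0ˡ 0≤uv 0≤vu sum≡0 , +≡0ʳ 0≤uv 0≤vu sum≡0
      where
      0≤uv = 0≤mass (separates? (source e) (target e) ∘ set) w≥0
      0≤vu = 0≤mass (separates? (target e) (source e) ∘ set) w≥0
      sum≡0 = ℚ.≤-antisym
        (subst (separation 𝒞 (source e) (target e) + separation 𝒞 (target e) (source e) ≤_) load≡0 (separation≤load e))
        (0≤+ 0≤uv 0≤vu)

  -- Meta-nodes and merging

  merge-inside : ∀ {u v M x} → x ∈ M u ∪ M v → merge P u v M x ≡ M u ∪ M v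
  merge-inside {u} {v} {M} {x} x∈ with x ∈? (M u ∪ M v)
  ... | yes _ = refl
  ... | no x∉ = contradiction x∈ x∉

  merge-outside : ∀ {u v M x} → x ∉ M u ∪ M v → merge P u v M x ≡ M x
  merge-outside {u} {v} {M} {x} x∉ with x ∈? (M u ∪ M v)
  ... | yes x∈ = contradiction x∈ x∉
  ... | no _   = refl

  -- A partition, encoded by a map that is constant on each class. `unseparated` is stated in one
  -- direction; `symmetric` supplies the other.
  record IsMetaNodes (𝒞 : Family P) (M : MetaNodes P) : Set where
    field
      self        : ∀ x → x ∈ M x
      class       : ∀ {x y} → y ∈ M x → M y ≡ M x
      unseparated : ∀ {x y} → y ∈ M x → separation 𝒞 x y ≡ 0ℚ

    symmetric : ∀ {x y} → y ∈ M x → x ∈ M y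
    symmetric {x} y∈Mx = subst (x ∈_) (sym (class y∈Mx)) (self x)

    union-class : ∀ {u v x y} → x ∈ M u ∪ M v → y ∈ M x → y ∈ M u ∪ M v
    union-class {u} {v} {x} {y} x∈ y∈Mx = x∈p∪q⁺ ([ (λ x∈Mu → inj₁ (subst (y ∈_) (class x∈Mu) y∈Mx))
                                            , (λ x∈Mv → inj₂ (subst (y ∈_) (class x∈Mv) y∈Mx)) ]′
                                            (x∈p∪q⁻ (M u) (M v) x∈))

    merge-⊇ : ∀ {u v x y} → y ∈ M x → y ∈ merge P u v M x
    merge-⊇ {u} {v} {x} {y} y∈Mx with x ∈? (M u ∪ M v)
    ... | yes x∈ = union-class x∈ y∈Mx
    ... | no _   = y∈Mx

    merge-edge : ∀ u v → v ∈ merge P u v M u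
    merge-edge u v = subst (v ∈_) (sym (merge-inside {u} {v} {M} (x∈p∪q⁺ (inj₁ (self u))))) (x∈p∪q⁺ (inj₂ (self v)))

  open IsMetaNodes

  module _ {𝒞 : Family P} (w≥0 : NonNegative 𝒞) where

    merge-isMetaNodes : ∀ {M u v} → separation 𝒞 u v ≡ 0ℚ → separation 𝒞 v u ≡ 0ℚ →
      IsMetaNodes 𝒞 M → IsMetaNodes 𝒞 (merge P u v M)
    merge-isMetaNodes {M} {u} {v} u~v v~u meta = record
      { self = λ x → merge-⊇ meta (self meta x) ; class = λ {x} → class′ {x} ; unseparated = unseparated′ }
      where
      class′ : ∀ {x y} → y ∈ merge P u v M x → merge P u v M y ≡ merge P u v M x
      class′ {x} {y} y∈ with x ∈? (M u ∪ M v)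
      ... | yes _ = merge-inside {u} {v} {M} {y} y∈
      ... | no x∉ = trans (merge-outside {u} {v} {M} {y} (λ y∈uv → x∉ (union-class meta y∈uv (symmetric meta y∈))))
                          (class meta y∈)

      -- The vertex `u` serves as a hub: any two vertices of the union are compared through it,
      -- crossing the merged edge from the side of `v`.
      to : ∀ {x} → x ∈ M u ∪ M v → separation 𝒞 x u ≡ 0ℚ
      to x∈ = [ unseparated meta ∘ symmetric meta
              , (λ x∈Mv → separation-trans w≥0 (unseparated meta (symmetric meta x∈Mv)) v~u) ]′ (x∈p∪q⁻ (M u) (M v) x∈)

      from : ∀ {x} → x ∈ M u ∪ M v → separation 𝒞 u x ≡ 0ℚ
      from x∈ = [ unseparated meta
                , (λ x∈Mv → separation-trans w≥0 u~v (unseparated meta x∈Mv)) ]′ (x∈p∪q⁻ (M u) (M v) x∈)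

      unseparated′ : ∀ {x y} → y ∈ merge P u v M x → separation 𝒞 x y ≡ 0ℚ
      unseparated′ {x} {y} y∈ with x ∈? (M u ∪ M v)
      ... | yes x∈ = separation-trans w≥0 (to x∈) (from y∈)
      ... | no _   = unseparated meta y∈

    mergeAlong-isMetaNodes : ∀ {M} e → IsMetaNodes 𝒞 M → IsMetaNodes 𝒞 (mergeAlong P 𝒞 e M)
    mergeAlong-isMetaNodes e meta with load P 𝒞 e ℚ.≟ 0ℚ
    ... | no _       = meta
    ... | yes load≡0 = let u~v , v~u = unloaded⇒separation≡0 w≥0 e load≡0 in merge-isMetaNodes u~v v~u meta

    mergeAlong-⊇ : ∀ {M x y} e → IsMetaNodes 𝒞 M → y ∈ M x → y ∈ mergeAlong P 𝒞 e M x
    mergeAlong-⊇ e meta y∈Mx with load P 𝒞 e ℚ.≟ 0ℚ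
    ... | no _  = y∈Mx
    ... | yes _ = merge-⊇ meta y∈Mx

    mergeAlong-unloaded : ∀ {M} e → IsMetaNodes 𝒞 M → load P 𝒞 e ≡ 0ℚ → target e ∈ mergeAlong P 𝒞 e M (source e)
    mergeAlong-unloaded e meta load≡0 with load P 𝒞 e ℚ.≟ 0ℚ
    ... | yes _     = merge-edge meta (source e) (target e)
    ... | no load≢0 = contradiction load≡0 load≢0

    module _ {M : MetaNodes P} (meta : IsMetaNodes 𝒞 M) where

      private
        mergeAll : List E → MetaNodes P
        mergeAll = foldr (mergeAlong P 𝒞) M

        mergeAll-isMetaNodes : ∀ es → IsMetaNodes 𝒞 (mergeAll es)
        mergeAll-isMetaNodes []       = meta
        mergeAll-isMetaNodes (e ∷ es) = mergeAlong-isMetaNodes e (mergeAll-isMetaNodes es)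

        mergeAll-⊇ : ∀ {x y} es → y ∈ M x → y ∈ mergeAll es x
        mergeAll-⊇ []       y∈Mx = y∈Mx
        mergeAll-⊇ (e ∷ es) y∈Mx = mergeAlong-⊇ e (mergeAll-isMetaNodes es) (mergeAll-⊇ es y∈Mx)

        mergeAll-unloaded : ∀ {e es} → e ∈ˡ es → load P 𝒞 e ≡ 0ℚ → target e ∈ mergeAll es (source e)
        mergeAll-unloaded {es = _ ∷ es} (here refl)  load≡0 = mergeAlong-unloaded _ (mergeAll-isMetaNodes es) load≡0
        mergeAll-unloaded {es = e ∷ es} (there e∈es) load≡0 =
          mergeAlong-⊇ e (mergeAll-isMetaNodes es) (mergeAll-unloaded e∈es load≡0)

      mergeUnloaded-isMetaNodes : IsMetaNodes 𝒞 (mergeUnloaded P 𝒞 M)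
      mergeUnloaded-isMetaNodes = mergeAll-isMetaNodes (allFin m)

      mergeUnloaded-⊇ : ∀ {x y} → y ∈ M x → y ∈ mergeUnloaded P 𝒞 M x
      mergeUnloaded-⊇ = mergeAll-⊇ (allFin m)

      mergeUnloaded-unloaded : ∀ e → load P 𝒞 e ≡ 0ℚ → target e ∈ mergeUnloaded P 𝒞 M (source e)
      mergeUnloaded-unloaded e = mergeAll-unloaded (∈-allFin e)

  -- Invariants of the two loops

  owns? : ∀ j → Decidable {A = WeightedCut P} (λ C → owner C ≡ j)
  owns? j C = owner C Fin.≟ j

  -- Equality of families up to ownership, splitting and weightless cuts. Loads, depths and
  -- separations are all masses of predicates on `set`, so they agree.
  SameSetMasses : Family P → Family P → Set₁
  SameSetMasses 𝒞 𝒟 = ∀ {X : Subset n → Set} (X? : Decidable X) → mass (X? ∘ set) 𝒞 ≡ mass (X? ∘ set) 𝒟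

  module Run {𝒞₀ : Family P} (feasible : FractionalFeasible P capacity 𝒞₀) where
    open FractionalFeasible feasible
    open FractionalLaminar fractionalLaminar

    -- No operation of the algorithm creates a vertex set. Laminarity and avoidance of the sink are
    -- thus read off the input instead of being maintained.
    Original : Subset n → Set
    Original S = ∃ λ C → C ∈ˡ 𝒞₀ × set C ≡ S

    record Valid (C : WeightedCut P) : Set where
      constructor valid
      field
        weight≥0      : 0ℚ ≤ weight C
        containsOwner : r (owner C) ∈ set C
        original      : Original (set C)
    open Valid

    original-chain : ∀ {S S′ v} → Original S → Original S′ → v ∈ S → v ∈ S′ → S ⊆ S′ ⊎ S′ ⊆ S
    original-chain (C , C∈ , refl) (D , D∈ , refl) v∈S v∈S′ = ¬cross⇒⊆⊎⊇ v∈S v∈S′ (laminar C∈ D∈)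

    sink∉original : ∀ {S} → Original S → sink ∉ S
    sink∉original (C , C∈ , refl) = All.lookup avoidSink C∈

    reweigh-valid : ∀ {C a} → 0ℚ ≤ a → Valid C → Valid (record C { weight = a })
    reweigh-valid 0≤a v = valid 0≤a (containsOwner v) (original v)

    -- The value 1 for waiting terminals guarantees a full unit of cuts at the selected one. The
    -- value 0 for the others forces the owner of any cut of positive weight to be waiting.
    Owned : Family P → Subset k → Set
    Owned 𝒞 T′ = ∀ j → mass (owns? j) 𝒞 ≡ part (j ∈? T′) 1ℚ

    -- R₀ is what the selection of i leaves of the family once the cuts in K
    -- are taken out; the inner loop only redistributes the ownership of R₀.
    record Inner (i : T) (K R : Family P) (T′ : Subset k) (R₀ : Family P) : Set₁ where
      field
        i∉T′      : i ∉ T′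
        K-valid   : All Valid K
        R-valid   : All Valid R
        K-owner≢i : All (λ C → owner C ≢ i) K
        K-innermost : All (λ D → r i ∈ set D → All (λ C → set C ⊆ set D) K) R
        balance   : mass U? K ≡ mass (owns? i) R
        shares    : ∀ j → j ≢ i → mass (owns? j) K + mass (owns? j) R ≡ part (j ∈? T′) 1ℚ
        sameSets  : SameSetMasses R R₀

    nonNeg : ∀ {𝒞} → All Valid 𝒞 → NonNegative 𝒞
    nonNeg = All.map weight≥0

    disown : ∀ {i j 𝒞} → j ≢ i → All (λ C → owner C ≡ i) 𝒞 → NonNegative 𝒞 → mass (owns? j) 𝒞 ≡ 0ℚ
    disown {j = j} j≢i own≡i w≥0 = mass-none (owns? j) w≥0 (All.map (λ { refl _ i≡j → j≢i (sym i≡j) }) own≡i)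

    cutsNotOf-mass : ∀ {i j 𝒞} → j ≢ i → NonNegative 𝒞 → mass (owns? j) (cutsNotOf P i 𝒞) ≡ mass (owns? j) 𝒞
    cutsNotOf-mass {i} {j} {𝒞} j≢i w≥0 = begin
      mass (owns? j) (cutsNotOf P i 𝒞)
        ≡⟨ ℚ.+-identityˡ (mass (owns? j) (cutsNotOf P i 𝒞)) ⟨
      0ℚ + mass (owns? j) (cutsNotOf P i 𝒞)
        ≡⟨ cong (_+ mass (owns? j) (cutsNotOf P i 𝒞))
             (disown j≢i (All.all-filter (owns? i) 𝒞) (All.filter⁺ (owns? i) w≥0)) ⟨
      mass (owns? j) (cutsOf P i 𝒞) + mass (owns? j) (cutsNotOf P i 𝒞)
        ≡⟨ mass-filter-¬? (owns? j) (owns? i) 𝒞 ⟩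
      mass (owns? j) 𝒞 ∎
      where open ≡-Reasoning

    cutsNotOf-none : ∀ {i 𝒞} → NonNegative 𝒞 → mass (owns? i) (cutsNotOf P i 𝒞) ≡ 0ℚ
    cutsNotOf-none {i} {𝒞} w≥0 = mass-none (owns? i) (All.filter⁺ (¬? ∘ owns? i) w≥0)
      (All.map (λ own≢i _ → own≢i) (All.all-filter (¬? ∘ owns? i) 𝒞))

    -- One reassignment

    module _ {i K R T′ R₀} (inv : Inner i K R T′ R₀) {C K′ L}
             (K↭C∷K′ : K ↭ C ∷ K′) (own∈T′ : owner C ∈ T′) (L↭ : L ↭ cutsOf P i R) where
      open Inner inv

      private
        w  = weight C
        I  = proj₁ (innermost P w L)
        I⁺ = proj₂ (innermost P w L)
        Rᵢ = cutsNotOf P i R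
        give : WeightedCut P → WeightedCut P
        give D = record D { owner = owner C }

        K-valid′ : All Valid (C ∷ K′)
        K-valid′ = ↭.All-resp-↭ K↭C∷K′ K-valid

        own≢i : owner C ≢ i
        own≢i = All.head (↭.All-resp-↭ K↭C∷K′ K-owner≢i)

        Above : WeightedCut P → Set
        Above D = (Valid D × owner D ≡ i) × (r i ∈ set D → All (λ C → set C ⊆ set D) (C ∷ K′))

        R-above : All (λ D → r i ∈ set D → All (λ C → set C ⊆ set D) (C ∷ K′)) R
        R-above = All.map (λ above i∈D → ↭.All-resp-↭ K↭C∷K′ (above i∈D)) K-innermost

        L-above : All Above L
        L-above = ↭.All-resp-↭ (↭-sym L↭) (All.zip
          ( All.zip (All.filter⁺ (owns? i) R-valid , All.all-filter (owns? i) R)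
          , All.filter⁺ (owns? i) R-above))

        pieces : All Above I × All Above I⁺
        pieces = innermost-All (λ { 0≤a ((v , own) , above) → (reweigh-valid 0≤a v , own) , above }) w L L-above

        I-above  = proj₁ pieces
        I⁺-above = proj₂ pieces

        I⁺-valid : All Valid I⁺
        I⁺-valid = All.map (proj₁ ∘ proj₁) I⁺-above

        Rᵢ-valid : All Valid Rᵢ
        Rᵢ-valid = All.filter⁺ (¬? ∘ owns? i) R-valid

        -- A cut `D` of i in R contains `r i`, hence encloses every cut of K, in particular `C`,
        -- which contains the vertex of the new owner. This is why K consists of innermost cuts.
        give-valid : ∀ {D} → Above D → Valid (give D)
        give-valid ((v , refl) , above) =
          valid (weight≥0 v) (All.head (above (containsOwner v)) (containsOwner (All.head K-valid′))) (original v)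

        L-mass : mass U? L ≡ w + mass U? K′
        L-mass = begin
          mass U? L               ≡⟨ mass-↭ U? L↭ ⟩
          mass U? (cutsOf P i R)  ≡⟨ mass-U-filter (owns? i) R ⟩
          mass (owns? i) R        ≡⟨ balance ⟨
          mass U? K               ≡⟨ mass-↭ U? K↭C∷K′ ⟩
          w + mass U? K′          ∎
          where open ≡-Reasoning

        -- By `balance`, i owns as much in R as is still in K, so it can pay for `C` in full.
        I-mass : mass U? I ≡ w
        I-mass = innermost-weight w L (weight≥0 (All.head K-valid′))
          (subst (w ≤_) (sym L-mass) (0≤b⇒a≤a+b (0≤mass U? (nonNeg (All.tail K-valid′)))))

        I⁺-mass : mass U? I⁺ ≡ mass U? K′
        I⁺-mass = +-cancelˡ-≡ w (begin
          w + mass U? I⁺          ≡⟨ cong (_+ mass U? I⁺) I-mass ⟨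
          mass U? I + mass U? I⁺  ≡⟨ innermost-mass U? (λ _ _ → refl) w L ⟩
          mass U? L               ≡⟨ L-mass ⟩
          w + mass U? K′          ∎)
          where open ≡-Reasoning

        give-mass : ∀ j → mass (owns? j) (map give I) ≡ part (owns? j C) w
        give-mass j = begin
          mass (owns? j) (map give I)   ≡⟨ mass-map give (owns? j) (λ _ → owns? j C) (λ _ → refl) (λ _ → refl) I ⟩
          mass (λ _ → owns? j C) I      ≡⟨ mass-const (owns? j C) I ⟩
          part (owns? j C) (mass U? I)  ≡⟨ cong (part (owns? j C)) I-mass ⟩
          part (owns? j C) w            ∎
          where open ≡-Reasoning

        mass-R′ : ∀ {X : WeightedCut P → Set} (X? : Decidable X) →
          mass X? (map give I ++ I⁺ ++ Rᵢ) ≡ mass X? (map give I) + (mass X? I⁺ + mass X? Rᵢ)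
        mass-R′ X? = trans (mass-++ X? (map give I) (I⁺ ++ Rᵢ)) (cong (mass X? (map give I) +_) (mass-++ X? I⁺ Rᵢ))

        balance′ : mass U? K′ ≡ mass (owns? i) (map give I ++ I⁺ ++ Rᵢ)
        balance′ = sym (begin
          mass (owns? i) (map give I ++ I⁺ ++ Rᵢ)
            ≡⟨ mass-R′ (owns? i) ⟩
          mass (owns? i) (map give I) + (mass (owns? i) I⁺ + mass (owns? i) Rᵢ)
            ≡⟨ cong₂ _+_ (trans (give-mass i) (part-no (owns? i C) own≢i))
                 (cong₂ _+_ (mass-cong (owns? i) U? (nonNeg I⁺-valid) (All.map _ I⁺-above)
                                       (All.map (λ ((_ , own) , _) _ _ → own) I⁺-above))
                            (cutsNotOf-none {i} {R} (nonNeg R-valid))) ⟩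
          0ℚ + (mass U? I⁺ + 0ℚ)
            ≡⟨ trans (ℚ.+-identityˡ (mass U? I⁺ + 0ℚ)) (ℚ.+-identityʳ (mass U? I⁺)) ⟩
          mass U? I⁺
            ≡⟨ I⁺-mass ⟩
          mass U? K′ ∎)
          where open ≡-Reasoning

        -- What the owner of `C` loses in K it regains in R, so only the sum over both parts is
        -- invariant.
        shares′ : ∀ j → j ≢ i →
          mass (owns? j) K′ + mass (owns? j) (map give I ++ I⁺ ++ Rᵢ) ≡ part (j ∈? T′) 1ℚ
        shares′ j j≢i = begin
          k′ + mass (owns? j) (map give I ++ I⁺ ++ Rᵢ)
            ≡⟨ cong (k′ +_) (mass-R′ (owns? j)) ⟩
          k′ + (mass (owns? j) (map give I) + (mass (owns? j) I⁺ + mass (owns? j) Rᵢ))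
            ≡⟨ cong (k′ +_) (cong₂ _+_ (give-mass j)
                 (cong₂ _+_ (disown j≢i (All.map (proj₂ ∘ proj₁) I⁺-above) (nonNeg I⁺-valid))
                            (cutsNotOf-mass j≢i (nonNeg R-valid)))) ⟩
          k′ + (part (owns? j C) w + (0ℚ + mass (owns? j) R))
            ≡⟨ regroup k′ (part (owns? j C) w) (mass (owns? j) R) ⟩
          (part (owns? j C) w + k′) + mass (owns? j) R
            ≡⟨ cong (_+ mass (owns? j) R) (mass-↭ (owns? j) K↭C∷K′) ⟨
          mass (owns? j) K + mass (owns? j) R
            ≡⟨ shares j j≢i ⟩
          part (j ∈? T′) 1ℚ ∎
          where
          open ≡-Reasoning
          k′ = mass (owns? j) K′
          regroup : ∀ a b c → a + (b + (0ℚ + c)) ≡ (b + a) + c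
          regroup = solve 3 (λ a b c → a :+ (b :+ (con 0ℚ :+ c)) := (b :+ a) :+ c) refl

        sameSets′ : SameSetMasses (map give I ++ I⁺ ++ Rᵢ) R₀
        sameSets′ X? = begin
          mass X?′ (map give I ++ I⁺ ++ Rᵢ)
            ≡⟨ mass-R′ X?′ ⟩
          mass X?′ (map give I) + (mass X?′ I⁺ + mass X?′ Rᵢ)
            ≡⟨ cong (_+ (mass X?′ I⁺ + mass X?′ Rᵢ)) (mass-map give X?′ X?′ (λ _ → refl) (λ _ → refl) I) ⟩
          mass X?′ I + (mass X?′ I⁺ + mass X?′ Rᵢ)
            ≡⟨ ℚ.+-assoc (mass X?′ I) (mass X?′ I⁺) (mass X?′ Rᵢ) ⟨
          mass X?′ I + mass X?′ I⁺ + mass X?′ Rᵢ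
            ≡⟨ cong (_+ mass X?′ Rᵢ) (trans (innermost-mass X?′ (λ _ _ → refl) w L) (mass-↭ X?′ L↭)) ⟩
          mass X?′ (cutsOf P i R) + mass X?′ Rᵢ
            ≡⟨ mass-filter-¬? X?′ (owns? i) R ⟩
          mass X?′ R
            ≡⟨ sameSets X? ⟩
          mass X?′ R₀ ∎
          where
          open ≡-Reasoning
          X?′ = X? ∘ set

      reassign-inner : Inner i K′ (map give I ++ I⁺ ++ Rᵢ) T′ R₀
      reassign-inner = record
        { i∉T′      = i∉T′
        ; K-valid   = All.tail K-valid′
        ; R-valid   = All.++⁺ (All.map⁺ (All.map give-valid I-above)) (All.++⁺ I⁺-valid Rᵢ-valid)
        ; K-owner≢i = All.tail (↭.All-resp-↭ K↭C∷K′ K-owner≢i)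
        ; K-innermost = All.map (All.tail ∘_)
            (All.++⁺ (All.map⁺ (All.map proj₂ I-above))
            (All.++⁺ (All.map proj₂ I⁺-above) (All.filter⁺ (¬? ∘ owns? i) R-above)))
        ; balance   = balance′
        ; shares    = shares′
        ; sameSets  = sameSets′
        }

    -- The end of the inner loop

    record Next (𝒞 : Family P) (T′ : Subset k) (R₀ : Family P) : Set₁ where
      field
        valids   : All Valid 𝒞
        owned    : Owned 𝒞 T′
        sameSets : SameSetMasses 𝒞 R₀

    -- The owners left in K are finished terminals other than i, so by `shares` their cuts weigh
    -- nothing. By `balance` i then owns no weight either, and `K ++ R` carries the same weights as
    -- R.
    finish-next : ∀ {i K R T′ R₀} → Inner i K R T′ R₀ → All (λ C → owner C ∉ T′) K → Next (K ++ R) T′ R₀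
    finish-next {i} {K} {R} {T′} {R₀} inv own∉T′ = record
      { valids = All.++⁺ K-valid R-valid ; owned = owned ; sameSets = sameSets′ }
      where
      open Inner inv

      K-weightless : ∀ {C} → C ∈ˡ K → ¬ 0ℚ < weight C
      K-weightless {C} C∈K 0<w = mass≤0⇒none (owns? j) (nonNeg K-valid) (ℚ.≤-reflexive mass≡0) C∈K 0<w refl
        where
        j = owner C
        mass≡0 : mass (owns? j) K ≡ 0ℚ
        mass≡0 = +≡0ˡ (0≤mass (owns? j) (nonNeg K-valid)) (0≤mass (owns? j) (nonNeg R-valid))
          (trans (shares j (All.lookup K-owner≢i C∈K)) (part-no (j ∈? T′) (All.lookup own∉T′ C∈K)))

      K-mass : ∀ {X : WeightedCut P → Set} (X? : Decidable X) → mass X? K ≡ 0ℚ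
      K-mass X? = mass-none X? (nonNeg K-valid) (All.tabulate λ C∈K 0<w _ → K-weightless C∈K 0<w)

      owned : Owned (K ++ R) T′
      owned j with j Fin.≟ i
      ... | no j≢i   = trans (mass-++ (owns? j) K R) (shares j j≢i)
      ... | yes refl = trans (mass-++ (owns? i) K R)
        (trans (cong₂ _+_ (K-mass (owns? i)) (trans (sym balance) (K-mass U?))) (sym (part-no (i ∈? T′) i∉T′)))

      sameSets′ : SameSetMasses (K ++ R) R₀
      sameSets′ X? = trans (mass-++ (X? ∘ set) K R)
        (trans (cong (_+ mass (X? ∘ set) R) (K-mass (X? ∘ set)))
        (trans (ℚ.+-identityˡ (mass (X? ∘ set) R)) (sameSets X?)))

    -- Selecting a terminal

    module Select {𝒞 T′} (valids : All Valid 𝒞) (owned : Owned 𝒞 T′) {i L} (i∈T′ : i ∈ T′)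
                  (L↭ : L ↭ cutsAt P (r i) 𝒞) (nested : Nested P L) where
      K  = proj₁ (innermost P 1ℚ L)
      K⁺ = proj₂ (innermost P 1ℚ L)
      K₀ = cutsNotOf P i K
      N  = cutsNotAt P (r i) 𝒞
      R₀ = K⁺ ++ N

      at? : Decidable {A = WeightedCut P} (λ C → r i ∈ set C)
      at? C = r i ∈? set C

      private
        Here : WeightedCut P → Set
        Here C = Valid C × r i ∈ set C

        pieces : All Here K × All Here K⁺
        pieces = innermost-All (λ { 0≤a (v , i∈C) → reweigh-valid 0≤a v , i∈C }) 1ℚ L
          (↭.All-resp-↭ (↭-sym L↭) (All.zip (All.filter⁺ at? valids , All.all-filter at? 𝒞)))

      K-valid : All Valid K
      K-valid = All.map proj₁ (proj₁ pieces)

      K-here : All (λ C → r i ∈ set C) K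
      K-here = All.map proj₂ (proj₁ pieces)

      K⁺-valid : All Valid K⁺
      K⁺-valid = All.map proj₁ (proj₂ pieces)

      N-away : All (λ C → r i ∉ set C) N
      N-away = All.all-filter (¬? ∘ at?) 𝒞

      K⊆K⁺ : All (λ D → All (λ C → set C ⊆ set D) K) K⁺
      K⊆K⁺ = innermost-⊆ 1ℚ nested

      R₀-valid : All Valid R₀
      R₀-valid = All.++⁺ K⁺-valid (All.filter⁺ (¬? ∘ at?) valids)

      mass-split : ∀ {X : WeightedCut P → Set} (X? : Decidable X) →
        (∀ C a → does (X? (record C { weight = a })) ≡ does (X? C)) →
        mass X? K + mass X? R₀ ≡ mass X? 𝒞
      mass-split X? reweigh = begin
        mass X? K + mass X? R₀                 ≡⟨ cong (mass X? K +_) (mass-++ X? K⁺ N) ⟩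
        mass X? K + (mass X? K⁺ + mass X? N)   ≡⟨ ℚ.+-assoc (mass X? K) (mass X? K⁺) (mass X? N) ⟨
        mass X? K + mass X? K⁺ + mass X? N     ≡⟨ cong (_+ mass X? N) (innermost-mass X? reweigh 1ℚ L) ⟩
        mass X? L + mass X? N                  ≡⟨ cong (_+ mass X? N) (mass-↭ X? L↭) ⟩
        mass X? (cutsAt P (r i) 𝒞) + mass X? N ≡⟨ mass-filter-¬? X? at? 𝒞 ⟩
        mass X? 𝒞                              ∎
        where open ≡-Reasoning

      -- The unit owned by i consists of cuts around `r i`, so the depth there is at least 1.
      K-mass : mass U? K ≡ 1ℚ
      K-mass = innermost-weight 1ℚ L 0≤1 (begin
        1ℚ                          ≡⟨ part-yes (i ∈? T′) i∈T′ ⟨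
        part (i ∈? T′) 1ℚ           ≡⟨ owned i ⟨
        mass (owns? i) 𝒞            ≤⟨ mass-mono (owns? i) at? (nonNeg valids)
                                         (All.map (λ { v _ refl → containsOwner v }) valids) ⟩
        mass at? 𝒞                  ≡⟨ mass-U-filter at? 𝒞 ⟨
        mass U? (cutsAt P (r i) 𝒞)  ≡⟨ mass-↭ U? L↭ ⟨
        mass U? L                   ∎)
        where open ℚ.≤-Reasoning

      select-inner : Inner i K₀ R₀ (T′ Subset.- i) R₀
      select-inner = record
        { i∉T′      = x∉p-x T′ i
        ; K-valid   = All.filter⁺ (¬? ∘ owns? i) K-valid
        ; R-valid   = R₀-valid
        ; K-owner≢i = All.all-filter (¬? ∘ owns? i) K
        ; K-innermost = All.++⁺ (All.map (λ K⊆D _ → All.filter⁺ (¬? ∘ owns? i) K⊆D) K⊆K⁺)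
                              (All.map (λ i∉D i∈D → contradiction i∈D i∉D) N-away)
        -- Both sides complete the weight that i owns in K to 1: K weighs 1, and i owns 1 in the
        -- whole family.
        ; balance   = +-cancelˡ-≡ (mass (owns? i) K) (begin
            mass (owns? i) K + mass U? K₀          ≡⟨ cong (_+ mass U? K₀) (mass-U-filter (owns? i) K) ⟨
            mass U? (cutsOf P i K) + mass U? K₀    ≡⟨ mass-filter-¬? U? (owns? i) K ⟩
            mass U? K                              ≡⟨ K-mass ⟩
            1ℚ                                     ≡⟨ part-yes (i ∈? T′) i∈T′ ⟨
            part (i ∈? T′) 1ℚ                      ≡⟨ owned i ⟨
            mass (owns? i) 𝒞                       ≡⟨ mass-split (owns? i) (λ _ _ → refl) ⟨
            mass (owns? i) K + mass (owns? i) R₀   ∎)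
        ; shares    = λ j j≢i → begin
            mass (owns? j) K₀ + mass (owns? j) R₀  ≡⟨ cong (_+ mass (owns? j) R₀)
                                                        (cutsNotOf-mass j≢i (nonNeg K-valid)) ⟩
            mass (owns? j) K + mass (owns? j) R₀   ≡⟨ mass-split (owns? j) (λ _ _ → refl) ⟩
            mass (owns? j) 𝒞                       ≡⟨ owned j ⟩
            part (j ∈? T′) 1ℚ                      ≡⟨ part-⇔ (j ∈? T′) (j ∈? T′ Subset.- i)
                                                        (λ j∈T′ → x∈p∧x≢y⇒x∈p-y j∈T′ j≢i) (p─q⊆p T′ _) ⟩
            part (j ∈? T′ Subset.- i) 1ℚ           ∎
        ; sameSets  = λ _ → refl
        }
        where open ≡-Reasoning

    -- Here `p` and `q` limit how often the edge can still be cut from its source side and from its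
    -- target side. Any integers above the separations will do, so rounding happens only once, in
    -- `initial-outer`.
    Budget : Family P → (T → Subset n) → E → Set
    Budget 𝒞 A e = ∃ λ p → ∃ λ q →
      separation 𝒞 (source e) (target e) ≤ fromℕ p ×
      separation 𝒞 (target e) (source e) ≤ fromℕ q ×
      integralLoad P A e ℕ.+ (p ℕ.+ q) ℕ.≤ suc (capacity e)

    -- Unloaded edges are merged only at the end of a round, so in the first
    -- round there may be unloaded edges that are not merged yet.
    data EdgeState (𝒞 : Family P) (A : T → Subset n) (M : MetaNodes P) (e : E) : Set where
      merged    : target e ∈ M (source e) → integralLoad P A e ℕ.≤ suc (capacity e) → EdgeState 𝒞 A M e
      untouched : load P 𝒞 e ≡ 0ℚ → integralLoad P A e ℕ.≤ 0 → EdgeState 𝒞 A M e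
      loaded    : 0ℚ < load P 𝒞 e → Budget 𝒞 A e → EdgeState 𝒞 A M e

    record Outer (𝒞 : Family P) (T′ : Subset k) (A : T → Subset n) (M : MetaNodes P) : Set where
      field
        valids   : All Valid 𝒞
        owned    : Owned 𝒞 T′
        meta     : IsMetaNodes 𝒞 M
        assigned : ∀ {j} → j ∉ T′ → r j ∈ A j × sink ∉ A j
        edges    : ∀ e → EdgeState 𝒞 A M e

    budget⇒≤ : ∀ {𝒞 A e} → Budget 𝒞 A e → integralLoad P A e ℕ.≤ suc (capacity e)
    budget⇒≤ (p , q , _ , _ , le) = ℕ.m+n≤o⇒m≤o _ le

    edgeState⇒≤ : ∀ {𝒞 A M e} → EdgeState 𝒞 A M e → integralLoad P A e ℕ.≤ suc (capacity e)
    edgeState⇒≤ (merged _ le)    = le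
    edgeState⇒≤ (untouched _ le) = ℕ.≤-trans le z≤n
    edgeState⇒≤ {𝒞} {A} (loaded _ b) = budget⇒≤ {𝒞} {A} b

    -- One round of the outer loop

    module Round {𝒞 T′ A M} (state : Outer 𝒞 T′ A M) {i L} (i∈T′ : i ∈ T′)
                 (max : ∀ j → j ∈ T′ → depth P 𝒞 (r j) ≤ depth P 𝒞 (r i))
                 (L↭ : L ↭ cutsAt P (r i) 𝒞) (nested : Nested P L) where
      open Outer state
      open Select valids owned i∈T′ L↭ nested

      Z : Subset n
      Z = M (r i)

      A′ : T → Subset n
      A′ = updateAt A i (const Z)

      w≥0 : NonNegative 𝒞
      w≥0 = nonNeg valids

      K≤𝒞 : ∀ {X : Subset n → Set} (X? : Decidable X) → mass (X? ∘ set) K ≤ mass (X? ∘ set) 𝒞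
      K≤𝒞 X? = subst (mass (X? ∘ set) K ≤_) (mass-split (X? ∘ set) (λ _ _ → refl))
        (0≤b⇒a≤a+b (0≤mass (X? ∘ set) (nonNeg R₀-valid)))

      R₀≤𝒞 : ∀ {X : Subset n → Set} (X? : Decidable X) → mass (X? ∘ set) R₀ ≤ mass (X? ∘ set) 𝒞
      R₀≤𝒞 X? = subst (mass (X? ∘ set) R₀ ≤_) (mass-split (X? ∘ set) (λ _ _ → refl))
        (0≤a⇒b≤a+b (0≤mass (X? ∘ set) (nonNeg K-valid)))

      reach : ∀ {u} → u ∈ Z → separation 𝒞 (r i) u ≡ 0ℚ
      reach = unseparated meta

      -- Either K contains v, and then so does everything in K⁺, or K lies
      -- entirely on the side of u and its whole weight 1 is saved.
      separation-drop : ∀ {u v} p → u ∈ Z → separation 𝒞 u v ≤ fromℕ (suc p) → separation R₀ u v ≤ fromℕ p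
      separation-drop {u} {v} p u∈Z sep≤ with Any.any? (λ C → v ∈? set C) K
      ... | yes v∈K = ℚ.≤-trans (ℚ.≤-reflexive (separation≡0 (nonNeg R₀-valid)
              (λ D∈R₀ 0<w u∈D → All.lookup v∈R₀ D∈R₀ (together (nonNeg R₀-valid) u~i D∈R₀ 0<w u∈D)))) (0≤fromℕ p)
        where
        u~i : separation R₀ u (r i) ≡ 0ℚ
        -- A cut of positive weight in `R₀` around `u` also contains `r i`, as both vertices lie in
        -- `Z`. So it is in `K⁺` and encloses the cut of K that contains `v`.
        u~i = ℚ.≤-antisym
          (subst (separation R₀ u (r i) ≤_) (unseparated meta (symmetric meta u∈Z)) (R₀≤𝒞 (separates? u (r i))))
          (0≤mass (separates? u (r i) ∘ set) (nonNeg R₀-valid))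
        v∈R₀ : All (λ D → r i ∈ set D → v ∈ set D) R₀
        v∈R₀ = let C , C∈K , v∈C = find v∈K in
          All.++⁺ (All.map (λ K⊆D _ → All.lookup K⊆D C∈K v∈C) K⊆K⁺)
                  (All.map (λ i∉D i∈D → contradiction i∈D i∉D) N-away)
      ... | no v∉K = +-cancelˡ-≤ 1ℚ (subst (_≤ fromℕ (suc p)) (begin
          separation 𝒞 u v                     ≡⟨ mass-split (separates? u v ∘ set) (λ _ _ → refl) ⟨
          separation K u v + separation R₀ u v ≡⟨ cong (_+ separation R₀ u v) K-separates ⟩
          1ℚ + separation R₀ u v               ∎) sep≤)
        where
        open ≡-Reasoning
        i~u : separation K (r i) u ≡ 0ℚ
        i~u = ℚ.≤-antisym (subst (separation K (r i) u ≤_) (reach u∈Z) (K≤𝒞 (separates? (r i) u)))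
                          (0≤mass (separates? (r i) u ∘ set) (nonNeg K-valid))
        K-separates : separation K u v ≡ 1ℚ
        K-separates = trans (mass-cong (separates? u v ∘ set) U? (nonNeg K-valid) (All.tabulate _)
          (All.tabulate λ C∈K 0<w _ → together (nonNeg K-valid) i~u C∈K 0<w (All.lookup K-here C∈K)
                                    , All.lookup (All.¬Any⇒All¬ K v∉K) C∈K)) K-mass

      -- If no weight separates u ∈ Z from v while a cut D separates v from u,
      -- then D's owner lies in D and in all cuts at r i, so it is deeper than i.
      separation-exhausted : ∀ {u v D} → u ∈ Z → D ∈ˡ 𝒞 → 0ℚ < weight D →
        Separates u v (set D) ⊎ Separates v u (set D) → ¬ separation 𝒞 u v ≤ 0ℚ
      separation-exhausted {u} {v} {D} u∈Z D∈𝒞 0<w (inj₁ u∣v) sep≤0 =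
        mass≤0⇒none (separates? u v ∘ set) w≥0 sep≤0 D∈𝒞 0<w u∣v
      separation-exhausted {u} {v} {D} u∈Z D∈𝒞 0<w (inj₂ (v∈D , u∉D)) sep≤0 = <⇒≱ deeper
        (subst₂ _≤_ (depth≡mass 𝒞 (r (owner D))) (depth≡mass 𝒞 (r i)) (max (owner D) own∈T′))
        where
        u~v : separation 𝒞 u v ≡ 0ℚ
        u~v = ℚ.≤-antisym sep≤0 (0≤mass (separates? u v ∘ set) w≥0)

        own∈T′ : owner D ∈ T′
        own∈T′ = decidable-stable (owner D ∈? T′) λ own∉T′ →
          mass≤0⇒none (owns? (owner D)) w≥0
            (ℚ.≤-reflexive (trans (owned (owner D)) (part-no (owner D ∈? T′) own∉T′))) D∈𝒞 0<w refl

        D-valid : Valid D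
        D-valid = All.lookup valids D∈𝒞

        D⊆ : ∀ {C} → C ∈ˡ 𝒞 → 0ℚ < weight C → r i ∈ set C → r (owner D) ∈ set C
        -- `C` contains `r i`, hence `u`, hence `v`. So `C` and `D` meet in `v` and are comparable,
        -- and `u`, which lies in `C` but not in `D`, leaves only `D` inside `C`.
        D⊆ C∈𝒞 0<wC i∈C with together w≥0 (reach u∈Z) C∈𝒞 0<wC i∈C
        ... | u∈C with original-chain (original D-valid) (original (All.lookup valids C∈𝒞))
                         v∈D (together w≥0 u~v C∈𝒞 0<wC u∈C)
        ...   | inj₁ D⊆C = D⊆C (containsOwner D-valid)
        ...   | inj₂ C⊆D = contradiction (C⊆D u∈C) u∉D

        deeper : mass at? 𝒞 < mass (λ C → r (owner D) ∈? set C) 𝒞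
        -- Strictness comes from `D` itself: if it contained `r i`, it would contain `u`.
        deeper = mass-mono-< at? (λ C → r (owner D) ∈? set C) w≥0 (All.tabulate D⊆) D∈𝒞 0<w
          (u∉D ∘ together w≥0 (reach u∈Z) D∈𝒞 0<w) (containsOwner D-valid)

      integralLoad≤suc : ∀ e → integralLoad P A′ e ℕ.≤ suc (integralLoad P A e)
      integralLoad≤suc e = integralLoad-≤-suc A′ A e i (λ j j≢i → updateAt-minimal j i A j≢i)

      integralLoad≤ : ∀ {e} → ¬ _∈δ_ P e Z → integralLoad P A′ e ℕ.≤ integralLoad P A e
      integralLoad≤ {e} e∉δZ = integralLoad-mono A′ A e uncut
        where
        uncut : ∀ j → _∈δ_ P e (A′ j) → _∈δ_ P e (A j)
        uncut j e∈δ with j Fin.≟ i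
        ... | yes refl = contradiction (subst (_∈δ_ P e) (updateAt-updates i A) e∈δ) e∉δZ
        ... | no j≢i   = subst (_∈δ_ P e) (updateAt-minimal j i A j≢i) e∈δ

      merged-uncut : ∀ {e} → target e ∈ M (source e) → ¬ _∈δ_ P e Z
      merged-uncut t∈Ms (inj₁ (s∈Z , t∉Z)) = t∉Z (subst (_ ∈_) (class meta s∈Z) t∈Ms)
      merged-uncut t∈Ms (inj₂ (t∈Z , s∉Z)) = s∉Z (subst (_ ∈_) (class meta t∈Z) (symmetric meta t∈Ms))

      module _ {𝒞′} (next : Next 𝒞′ (T′ Subset.- i) R₀) where
        open Next next renaming (valids to valids′; owned to owned′)

        M′ : MetaNodes P
        M′ = mergeUnloaded P 𝒞′ M

        𝒞′≤𝒞 : ∀ {X : Subset n → Set} (X? : Decidable X) → mass (X? ∘ set) 𝒞′ ≤ mass (X? ∘ set) 𝒞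
        𝒞′≤𝒞 X? = subst (_≤ mass (X? ∘ set) 𝒞) (sym (sameSets X?)) (R₀≤𝒞 X?)

        drop : ∀ {u v} p → u ∈ Z → separation 𝒞 u v ≤ fromℕ (suc p) → separation 𝒞′ u v ≤ fromℕ p
        drop {u} {v} p u∈Z sep≤ = subst (_≤ fromℕ p) (sym (sameSets (separates? u v))) (separation-drop p u∈Z sep≤)

        keep : ∀ {u v a} → separation 𝒞 u v ≤ a → separation 𝒞′ u v ≤ a
        keep {u} {v} = ℚ.≤-trans (𝒞′≤𝒞 (separates? u v))

        meta₀ : IsMetaNodes 𝒞′ M
        meta₀ = record
          { self = self meta ; class = class meta
          ; unseparated = λ {x} {y} y∈ → ℚ.≤-antisym
              (subst (separation 𝒞′ x y ≤_) (unseparated meta y∈) (𝒞′≤𝒞 (separates? x y)))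
              (0≤mass (separates? x y ∘ set) (nonNeg valids′))
          }

        -- If `Z` cuts the edge, the budget on the side of `Z` drops by one and pays for the growth
        -- of the integral load. The other budget stays valid because separations never increase.
        budget-next : ∀ {e} → 0ℚ < load P 𝒞 e → Budget 𝒞 A e → Budget 𝒞′ A′ e
        budget-next {e} 0<load (p , q , s∣t≤p , t∣s≤q , ≤c) with _∈δ?_ P e Z
        ... | no e∉δZ = p , q , keep s∣t≤p , keep t∣s≤q , ℕ.≤-trans (ℕ.+-monoˡ-≤ (p ℕ.+ q) (integralLoad≤ e∉δZ)) ≤c
        -- Positive load supplies the cut `D` across the edge with which `separation-exhausted`
        -- rules out a zero budget on the side of `Z`.
        ... | yes e∈δZ with mass>0⇒some (_∈δ?_ P e ∘ set) w≥0 (subst (0ℚ <_) (load≡mass 𝒞 e) 0<load)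
        ...   | D , D∈𝒞 , 0<w , e∈δD = cut-from e∈δZ p q s∣t≤p t∣s≤q ≤c
          where
          cut-from : _∈δ_ P e Z → ∀ p q →
            separation 𝒞 (source e) (target e) ≤ fromℕ p → separation 𝒞 (target e) (source e) ≤ fromℕ q →
            integralLoad P A e ℕ.+ (p ℕ.+ q) ℕ.≤ suc (capacity e) → Budget 𝒞′ A′ e
          cut-from (inj₁ (s∈Z , _)) zero q s∣t≤0 _ _ =
            contradiction s∣t≤0 (separation-exhausted s∈Z D∈𝒞 0<w e∈δD)
          cut-from (inj₁ (s∈Z , _)) (suc p) q s∣t≤ t∣s≤ ≤c = p , q , drop p s∈Z s∣t≤ , keep t∣s≤ ,
            ℕ.≤-trans (ℕ.+-monoˡ-≤ (p ℕ.+ q) (integralLoad≤suc e))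
              (subst (ℕ._≤ suc (capacity e)) (ℕ.+-suc (integralLoad P A e) (p ℕ.+ q)) ≤c)
          cut-from (inj₂ (t∈Z , _)) p zero _ t∣s≤0 _ =
            contradiction t∣s≤0 (separation-exhausted t∈Z D∈𝒞 0<w (Sum.swap e∈δD))
          cut-from (inj₂ (t∈Z , _)) p (suc q) s∣t≤ t∣s≤ ≤c = p , q , keep s∣t≤ , drop q t∈Z t∣s≤ ,
            ℕ.≤-trans (ℕ.+-monoˡ-≤ (p ℕ.+ q) (integralLoad≤suc e))
              (subst (ℕ._≤ suc (capacity e)) (trans (cong (integralLoad P A e ℕ.+_) (ℕ.+-suc p q))
                                                    (ℕ.+-suc (integralLoad P A e) (p ℕ.+ q))) ≤c)

        load≥0 : ∀ e → 0ℚ ≤ load P 𝒞′ e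
        load≥0 e = subst (0ℚ ≤_) (sym (load≡mass 𝒞′ e)) (0≤mass (_∈δ?_ P e ∘ set) (nonNeg valids′))

        load-mono : ∀ e → load P 𝒞′ e ≤ load P 𝒞 e
        load-mono e = subst₂ _≤_ (sym (load≡mass 𝒞′ e)) (sym (load≡mass 𝒞 e)) (𝒞′≤𝒞 (_∈δ?_ P e))

        edge-next : ∀ e → EdgeState 𝒞 A M e → EdgeState 𝒞′ A′ M′ e
        edge-next e (merged t∈Ms ≤c) = merged (mergeUnloaded-⊇ (nonNeg valids′) meta₀ t∈Ms)
          (ℕ.≤-trans (integralLoad≤ (merged-uncut t∈Ms)) ≤c)
        edge-next e (untouched load≡0 ≤0) = merged
          (mergeUnloaded-unloaded (nonNeg valids′) meta₀ e
            (ℚ.≤-antisym (subst (load P 𝒞′ e ≤_) load≡0 (load-mono e)) (load≥0 e)))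
          (ℕ.≤-trans (integralLoad≤suc e) (s≤s (ℕ.≤-trans ≤0 z≤n)))
        edge-next e (loaded 0<load budget) with load P 𝒞′ e ℚ.≟ 0ℚ
        ... | yes load≡0 = merged (mergeUnloaded-unloaded (nonNeg valids′) meta₀ e load≡0)
                                  (budget⇒≤ {𝒞′} {A′} (budget-next 0<load budget))
        ... | no load≢0  = loaded (≤∧≢0⇒0< (load≥0 e) load≢0) (budget-next 0<load budget)

        -- A waiting i owns a cut of positive weight around `r i`. It contains all of `Z` but,
        -- having an original set, not the sink.
        sink∉Z : sink ∉ Z
        sink∉Z sink∈Z with mass>0⇒some (owns? i) w≥0
                             (subst (0ℚ <_) (sym (trans (owned i) (part-yes (i ∈? T′) i∈T′))) (ℚ.positive⁻¹ 1ℚ))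
        ... | D , D∈𝒞 , 0<w , refl = sink∉original (original (All.lookup valids D∈𝒞))
          (together w≥0 (reach sink∈Z) D∈𝒞 0<w (containsOwner (All.lookup valids D∈𝒞)))

        assigned′ : ∀ {j} → j ∉ T′ Subset.- i → r j ∈ A′ j × sink ∉ A′ j
        assigned′ {j} j∉ with j Fin.≟ i
        ... | yes refl = subst (λ S → r i ∈ S × sink ∉ S) (sym (updateAt-updates i A)) (self meta (r i) , sink∉Z)
        ... | no j≢i   = subst (λ S → r j ∈ S × sink ∉ S) (sym (updateAt-minimal j i A j≢i))
                           (assigned (λ j∈T′ → j∉ (x∈p∧x≢y⇒x∈p-y j∈T′ j≢i)))

        round-outer : Outer 𝒞′ (T′ Subset.- i) A′ M′
        round-outer = record
          { valids = valids′ ; owned = owned′ ; meta = mergeUnloaded-isMetaNodes (nonNeg valids′) meta₀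
          ; assigned = assigned′ ; edges = λ e → edge-next e (edges e) }

    -- Progress, termination and the final bound

    Feasible : (T → Subset n) → Set
    Feasible = IntegralFeasible P (suc ∘ capacity)

    -- Splitting may lengthen R, but every reassignment takes one cut out of K, so `l` bounds the
    -- number of iterations left. `continue` stands for the later rounds.
    inner-produces : ∀ {i R₀ T′ A M} →
      (∀ {𝒞} → Next 𝒞 T′ R₀ → Produces P Feasible (outer 𝒞 T′ A (mergeUnloaded P 𝒞 M))) →
      ∀ l {K R} → length K ℕ.≤ l → Inner i K R T′ R₀ → Produces P Feasible (inner i K R T′ A M)
    inner-produces {i} {R₀} {T′} {A} {M} continue l {K} {R} ∣K∣≤l inv = step progress (preserve l ∣K∣≤l)
      where
      open Inner inv
      progress : ∃ (_⟶_ P (inner i K R T′ A M))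
      progress with Any.any? (λ C → owner C ∈? T′) K
      ... | no own∉T′ = _ , finish (All.¬Any⇒All¬ K own∉T′)
      ... | yes own∈T′ with find own∈T′
      ...   | C , C∈K , own∈T′ with ∈-∃++ C∈K
      ...     | K₁ , K₂ , refl =
        let L , L↭ , nested = nested-sort (λ (o , v∈C) (o′ , v∈D) → original-chain o o′ v∈C v∈D)
              (All.zip ( All.map original (All.filter⁺ (owns? i) R-valid)
                       , All.map (λ { (v , refl) → containsOwner v })
                           (All.zip (All.filter⁺ (owns? i) R-valid , All.all-filter (owns? i) R))))
        in _ , reassign C (K₁ ++ K₂) L (↭.shift C K₁ K₂) own∈T′ L↭ nested

      preserve : ∀ l → length K ℕ.≤ l → ∀ {s} → _⟶_ P (inner i K R T′ A M) s → Produces P Feasible s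
      preserve l       ∣K∣≤l (finish own∉T′) = continue (finish-next inv own∉T′)
      preserve zero    ∣K∣≤l (reassign C K′ L K↭ _ _ _) with () ← subst (ℕ._≤ 0) (↭.↭-length K↭) ∣K∣≤l
      preserve (suc l) ∣K∣≤l (reassign C K′ L K↭ own∈T′ L↭ _) = inner-produces continue l
        (ℕ.s≤s⁻¹ (subst (ℕ._≤ suc l) (↭.↭-length K↭) ∣K∣≤l)) (reassign-inner inv K↭ own∈T′ L↭)

    all-assigned⇒feasible : ∀ {𝒞 T′ A M} → Outer 𝒞 T′ A M → (∀ j → j ∉ T′) → Feasible A
    all-assigned⇒feasible state j∉T′ = record
      { cuts         = λ j → (⊥⊆ , r j , proj₁ (assigned (j∉T′ j)) , ∉⊥)
                           , (⊆⊤ , sink , ∈⊤ , proj₂ (assigned (j∉T′ j)))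
      ; containOwner = λ j → proj₁ (assigned (j∉T′ j))
      ; avoidSink    = λ j → proj₂ (assigned (j∉T′ j))
      ; load≤        = λ e → edgeState⇒≤ (edges e)
      }
      where open Outer state

    outer-produces : ∀ {𝒞 T′ A M} → Acc Subset._⊂_ T′ → Outer 𝒞 T′ A M → Produces P Feasible (outer 𝒞 T′ A M)
    outer-produces {𝒞} {T′} {A} {M} (acc smaller) state with argmax (_∈? T′) (λ j → depth P 𝒞 (r j)) (allFin k)
    ... | inj₁ none = done (λ (j , j∈T′) → none (∈-allFin j) j∈T′)
                           (all-assigned⇒feasible state (λ j → none (∈-allFin j)))
    ... | inj₂ (i , i∈T′ , max) = step progress preserve
      where
      open Outer state
      progress : ∃ (_⟶_ P (outer 𝒞 T′ A M))
      progress =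
        let L , L↭ , nested = nested-sort (λ (o , v∈C) (o′ , v∈D) → original-chain o o′ v∈C v∈D)
              (All.zip ( All.map original (All.filter⁺ (λ C → r i ∈? set C) valids)
                       , All.all-filter (λ C → r i ∈? set C) 𝒞))
        in _ , select i L i∈T′ (λ j → max (∈-allFin j)) L↭ nested

      preserve : ∀ {s} → _⟶_ P (outer 𝒞 T′ A M) s → Produces P Feasible s
      -- This i is the choice made by the run, possibly not the maximiser found above, which only
      -- witnesses that some step exists.
      preserve (select i L i∈T′ max L↭ nested) = inner-produces
        (λ next → outer-produces (smaller (x∈p⇒p-x⊂p i∈T′)) (Round.round-outer state i∈T′ max L↭ nested next))
        _ ℕ.≤-refl (Select.select-inner valids owned i∈T′ L↭ nested)

    initial-outer : Outer 𝒞₀ Subset.⊤ (const Subset.⊥) Subset.⁅_⁆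
    initial-outer = record
      { valids   = valids
      ; owned    = λ j → trans (sym (sum-filter (owns? j) 𝒞₀)) (trans (unit j) (sym (part-yes (j ∈? Subset.⊤) ∈⊤)))
      ; meta     = record
        { self        = x∈⁅x⁆
        ; class       = λ {x} y∈ → cong Subset.⁅_⁆ (x∈⁅y⁆⇒x≡y x y∈)
        ; unseparated = λ {x} y∈ → separation≡0 nonNegative
            (λ {C} _ _ → subst (_∈ set C) (sym (x∈⁅y⁆⇒x≡y x y∈)))
        }
      ; assigned = λ j∉⊤ → contradiction ∈⊤ j∉⊤
      ; edges    = edge
      }
      where
      valids : All Valid 𝒞₀
      valids = All.tabulate λ {C} C∈ → valid (All.lookup nonNegative C∈) (All.lookup containOwner C∈) (C , C∈ , refl)

      -- The placeholder for a missing cut has no members, so waiting terminals add nothing to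
      -- integral loads.
      uncut : ∀ e → integralLoad P (const Subset.⊥) e ≡ 0
      uncut e = cong length (filter-none (λ i → _∈δ?_ P e Subset.⊥)
        (All.universal (λ _ → [ ∉⊥ ∘ proj₁ , ∉⊥ ∘ proj₁ ]′) (allFin k)))

      edge : ∀ e → EdgeState 𝒞₀ (const Subset.⊥) Subset.⁅_⁆ e
      edge e with load P 𝒞₀ e ℚ.≟ 0ℚ
      ... | yes load≡0 = untouched load≡0 (ℕ.≤-reflexive (uncut e))
      ... | no load≢0  =
        -- The additional unit of capacity arises here, from rounding two summands separately.
        let p , q , s∣t≤p , t∣s≤q , p+q≤c = integer-bounds (capacity e)
              (0≤mass (separates? (source e) (target e) ∘ set) nonNegative)
              (0≤mass (separates? (target e) (source e) ∘ set) nonNegative)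
              (ℚ.≤-trans (separation≤load nonNegative e) (subst (load P 𝒞₀ e ≤_) (/1≡fromℕ (capacity e)) (load≤ e)))
        in loaded
          (≤∧≢0⇒0< (subst (0ℚ ≤_) (sym (load≡mass 𝒞₀ e)) (0≤mass (_∈δ?_ P e ∘ set) nonNegative)) load≢0)
          (p , q , s∣t≤p , t∣s≤q , subst (λ N → N ℕ.+ (p ℕ.+ q) ℕ.≤ suc (capacity e)) (sym (uncut e)) p+q≤c)

lemma3 : (P : CSCP) (𝒞 : List (WeightedCut P)) →
    FractionalFeasible P (CSCP.capacity P) 𝒞 →
    Round1Produces P 𝒞 (IntegralFeasible P (λ e → suc (CSCP.capacity P e)))
lemma3 P 𝒞 feasible = outer-produces (⊂-wellFounded Subset.⊤) initial-outer
  where open Run P feasible
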